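{- Let $p$ be a prime and let $G$ be a finite abelian $p$-group with $|G| \ge p$. Then $\nu (G) = \nu_p (G) = \mathsf d (G)-1$.
   Context: For a finite abelian group $G$ (written additively) let $G^{\bullet} = G\setminus\{0\}$. A sequence over $G$ is a finite unordered sequence of elements of $G$ with repetition allowed (an element of the free abelian monoid with basis $G$, written multiplicatively; the empty sequence is allowed); $|T|$ is the length of $T$, and $\Sigma(T)$ is the set of all sums of nonempty subsequences of $T$. $T$ is zero-sum free if $0\notin\Sigma(T)$. $\mathsf d(G)$ is the maximal length of a zero-sum free sequence over $G$. For nontrivial $G$, $\nu(G)$ is the smallest integer $\ell\ge 0$ such that for every zero-sum free sequence $T$ over $G$ with $|T|\ge \ell$ there are a subgroup $H\subsetneq G$ and some $\alpha\in G\setminus H$ with $G^{\bullet}\setminus\Sigma(T)\subseteq\alpha+H$. For a prime divisor $p$ of $|G|$, $\nu_p(G)$ is the smallest integer $\ell\ge 0$ such that for every zero-sum free sequence $T$ over $G$ with $|T|\ge\ell$ there are a subgroup $H\subseteq G$ with index $(G:H)=p$ and some $\alpha\in G\setminus H$ with $G^{\bullet}\setminus\Sigma(T)\subseteq\alpha+H$. -}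

module Defs where

open import Algebra.Bundles using (AbelianGroup)
import Algebra.Properties.AbelianGroup as AbelianGroupProperties
open import Data.Fin.Base using (Fin)
open import Data.List.Base using (List; []; foldr; length)
import Data.List.Relation.Binary.Sublist.Setoid as Sublist
open import Data.Nat.Base using (ℕ; _≤_; _≥_)
open import Data.Product.Base using (Σ-syntax; ∃-syntax; _×_)
open import Function.Bundles using (Inverse)
open import Level using (Level; suc; _⊔_)
open import Relation.Binary.Bundles using (Setoid)
open import Relation.Binary.Definitions using (_Respects_)
open import Relation.Binary.PropositionalEquality.Core using (_≡_; _≢_)
open import Relation.Binary.PropositionalEquality.Properties using ()
  renaming (setoid to ≡-setoid)
open import Relation.Nullary.Negation.Core using (¬_)
open import Relation.Unary using (Pred; U; _∈_; _∉_; _⊆_; _⊂_; _∖_)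

HasCardinality : ∀ {c ℓ} → Setoid c ℓ → ℕ → Set (c ⊔ ℓ)
HasCardinality S n = Inverse S (≡-setoid (Fin n))

-- d(G), ν(G) and ν_p(G) are presented as relations "this number is the
-- largest/smallest one such that …"; antisymmetry of ≤ makes it unique.

IsSmallest IsLargest : ∀ {a} → Pred ℕ a → ℕ → Set a
IsSmallest P m = m ∈ P × (∀ n → n ∈ P → m ≤ n)
IsLargest  P m = m ∈ P × (∀ n → n ∈ P → n ≤ m)

module _ {c ℓ : Level} (G : AbelianGroup c ℓ) where

  open AbelianGroup G
    renaming (_∙_ to _+_; ε to 0#; _⁻¹ to -_; ∙-cong to +-cong; assoc to +-assoc)
  open AbelianGroupProperties G using (⁻¹-involutive; ⁻¹-∙-comm)

  HasOrder : ℕ → Set (c ⊔ ℓ)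
  HasOrder = HasCardinality setoid

  record Subgroup : Set (c ⊔ suc ℓ) where
    field
      ⟦_⟧      : Pred Carrier ℓ
      resp     : ⟦_⟧ Respects _≈_
      0#-mem   : 0# ∈ ⟦_⟧
      +-closed : ∀ {x y} → x ∈ ⟦_⟧ → y ∈ ⟦_⟧ → x + y ∈ ⟦_⟧
      neg-mem  : ∀ {x} → x ∈ ⟦_⟧ → - x ∈ ⟦_⟧

  open Subgroup using (⟦_⟧)

  Coset : Carrier → Subgroup → Pred Carrier (c ⊔ ℓ)
  Coset α H x = ∃[ h ] (h ∈ ⟦ H ⟧ × x ≈ α + h)

  Quotient : Subgroup → Setoid c ℓ
  Quotient H = record
    { Carrier       = Carrier
    ; _≈_           = λ x y → x + (- y) ∈ ⟦ H ⟧
    ; isEquivalence = record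
      { refl  = λ {x} → resp (sym (inverseʳ x)) 0#-mem
      ; sym   = λ {x} {y} xy → resp (flip-difference x y) (neg-mem xy)
      ; trans = λ {x} {y} {z} xy yz → resp (telescope x y z) (+-closed xy yz)
      }
    }
    where
    open Subgroup H using (resp; 0#-mem; +-closed; neg-mem)

    flip-difference : ∀ x y → - (x + (- y)) ≈ y + (- x)
    flip-difference x y =
      trans (sym (⁻¹-∙-comm x (- y)))
      (trans (+-cong refl (⁻¹-involutive y)) (comm (- x) y))

    telescope : ∀ x y z → (x + (- y)) + (y + (- z)) ≈ x + (- z)
    telescope x y z =
      trans (+-assoc x (- y) (y + (- z)))
      (+-cong refl
        (trans (sym (+-assoc (- y) y (- z)))
        (trans (+-cong (inverseˡ y) refl) (identityˡ (- z)))))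

  HasIndex : Subgroup → ℕ → Set (c ⊔ ℓ)
  HasIndex H = HasCardinality (Quotient H)

  -- A sequence over G is unordered; it is represented by a list in an
  -- arbitrary order.  Everything below is invariant under permuting it.

  Sequence : Set c
  Sequence = List Carrier

  open Sublist setoid using () renaming (_⊆_ to _⊑_)

  sum : Sequence → Carrier
  sum = foldr _+_ 0#

  SubsequenceSums : Sequence → Pred Carrier (c ⊔ ℓ)
  SubsequenceSums T g = ∃[ S ] (S ⊑ T × S ≢ [] × g ≈ sum S)

  ZeroSumFree : Sequence → Set (c ⊔ ℓ)
  ZeroSumFree T = 0# ∉ SubsequenceSums T

  Nonzero : Pred Carrier ℓ
  Nonzero g = ¬ (g ≈ 0#)

  Is-d : ℕ → Set (c ⊔ ℓ)
  Is-d = IsLargest λ n → ∃[ T ] (ZeroSumFree T × length T ≡ n)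

  Is-ν : ℕ → Set (c ⊔ suc ℓ)
  Is-ν = IsSmallest λ l →
    ∀ T → ZeroSumFree T → length T ≥ l →
    Σ[ H ∈ Subgroup ] (⟦ H ⟧ ⊂ U ×
      ∃[ α ] (α ∉ ⟦ H ⟧ × (Nonzero ∖ SubsequenceSums T) ⊆ Coset α H))

  Is-ν[_] : ℕ → ℕ → Set (c ⊔ suc ℓ)
  Is-ν[ p ] = IsSmallest λ l →
    ∀ T → ZeroSumFree T → length T ≥ l →
    Σ[ H ∈ Subgroup ] (HasIndex H p ×
      ∃[ α ] (α ∉ ⟦ H ⟧ × (Nonzero ∖ SubsequenceSums T) ⊆ Coset α H))

{-# OPTIONS --safe #-}
module Submission where

-- Identify T = g₁ ⋯ gₗ with the product ∏ (1 - X^gᵢ) in the group ring 𝔽ₚ[G], i.e. with the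
-- iterated difference N T of the function δ₀.  If T is zero-sum free then N T 0 = 1, and N T
-- vanishes off Σ(T) ∪ {0}.  Let e₁, …, eᵣ be independent generators of orders qᵢ = p^tᵢ.
-- Since (1 - X^eᵢ)^qᵢ = 1 - X^(qᵢ eᵢ) = 0, all (d + 1)-fold differences vanish for
-- d = ∑ (qᵢ - 1); hence zero-sum free sequences have length at most d, a bound attained by
-- ∏ eᵢ^(qᵢ - 1).  If |T| ≥ d - 1, the second differences of N T vanish, so N T = 1 + φ for a
-- homomorphism φ : G → 𝔽ₚ, and the elements missing from Σ(T) lie in φ⁻¹(-1), a coset of a
-- subgroup of index p (if φ = 0, nothing is missing).  Conversely, if g h S is zero-sum free
-- then -g, -h, -(g + h) are missing from Σ(S), and no coset α + H with α ∉ H contains all three.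

open import Defs
open import Algebra.Bundles using (AbelianGroup)
open import Data.Integer.Base using (+_; _-_; 1ℤ)
open import Data.Nat.Base using (ℕ; _^_; _≥_)
open import Data.Nat.Primality using (Prime)
open import Data.Product.Base using (∃-syntax; _×_)
open import Relation.Binary.PropositionalEquality.Core using (_≡_)

import Algebra.Properties.AbelianGroup as AbelianGroupProperties
import Algebra.Properties.CommutativeMonoid.Mult as CommutativeMonoidMult
import Algebra.Properties.CommutativeMonoid.Sum as CommutativeMonoidSum
open import Algebra.Properties.Monoid.Sum using () renaming (sum to monoidSum)
open import Data.Fin.Base using (Fin; zero; suc; toℕ; fromℕ<; punchIn)
open import Data.Fin.Permutation using (permutation)
import Data.Fin.Properties as Fin
open import Data.Integer.Base as ℤ using (ℤ; 0ℤ; _/ℕ_; _%ℕ_)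
import Data.Integer.Divisibility.Signed as ℤ
open import Data.Integer.DivMod using (a≡a%ℕn+[a/ℕn]*n; n%ℕd<d)
import Data.Integer.Properties as ℤ
open import Data.Integer.Tactic.RingSolver using (solve-∀)
open import Data.List.Base using ([]; _∷_; length; replicate; _++_)
import Data.List.Properties as List
import Data.List.Relation.Binary.Sublist.Setoid as Sublist
open import Data.Nat.Base as ℕ using (zero; suc; _<_; _≤_; z≤n; s≤s)
open import Data.Nat.Coprimality using (Coprime; coprime-Bézout)
open import Data.Nat.Divisibility as ℕ using (_∣_; _∣?_; quotient; _∣0; n∣m*n)
open import Data.Nat.GCD using (module Bézout)
open import Data.Nat.Primality
  using (euclidsLemma; ¬prime[0]; prime⇒nonZero; prime⇒nonTrivial; prime⇒irreducible)
import Data.Nat.Properties as ℕ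
import Data.Nat.Tactic.RingSolver as ℕ-Solver
open import Data.Product.Base using (Σ-syntax; _,_; proj₁; proj₂)
open import Data.Sum.Base using (inj₁; inj₂)
open import Data.Vec.Functional as Vector using (updateAt)
open import Data.Vec.Functional.Properties using (updateAt-updates; updateAt-minimal)
open import Function.Base using (id; _∘_; const)
open import Function.Bundles using (Inverse; Func)
open import Level using (Level; _⊔_; Lift; lift)
open import Relation.Binary.Bundles using (Setoid)
open import Relation.Binary.Definitions using (tri<; tri≈; tri>)
open import Relation.Binary.PropositionalEquality as ≡ using (_≢_; _≗_)
import Relation.Binary.Reasoning.Setoid as SetoidReasoning
open import Relation.Nullary using (¬_; Dec; yes; no; contradiction)
open import Relation.Nullary.Decidable using (map′; _×-dec_; ¬?; decidable-stable)
open import Relation.Unary using (_∉_; _⊆_; _∖_)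

-- Binomial coefficients.

-- choose a b is the binomial coefficient (a + b choose a).
choose : ℕ → ℕ → ℕ
choose zero    b       = 1
choose (suc a) zero    = 1
choose (suc a) (suc b) = choose a (suc b) ℕ.+ choose (suc a) b

choose-zeroʳ : ∀ a → choose a 0 ≡ 1
choose-zeroʳ zero    = ≡.refl
choose-zeroʳ (suc a) = ≡.refl

-- Absorption, kept free of division: when a + b + 1 is a prime, the right side is visibly a
-- multiple of it.
choose-absorb : ∀ a b → suc a ℕ.* choose (suc a) b ≡ suc (a ℕ.+ b) ℕ.* choose a b
choose-absorb zero zero = ≡.refl
choose-absorb zero (suc b) = begin
  1 ℕ.* (1 ℕ.+ choose 1 b) ≡⟨ ℕ.*-identityˡ _ ⟩
  1 ℕ.+ choose 1 b ≡⟨ ≡.cong (1 ℕ.+_) (ℕ.*-identityˡ _) ⟨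
  1 ℕ.+ 1 ℕ.* choose 1 b ≡⟨ ≡.cong (1 ℕ.+_) (choose-absorb 0 b) ⟩
  1 ℕ.+ suc b ℕ.* 1 ∎
  where open ≡.≡-Reasoning
choose-absorb (suc a) zero = ≡.cong (λ z → suc (suc z) ℕ.* 1) (≡.sym (ℕ.+-identityʳ a))
choose-absorb (suc a) (suc b) = begin
  suc (suc a) ℕ.* (x ℕ.+ y ℕ.+ choose (suc (suc a)) b)
    ≡⟨ ℕ.*-distribˡ-+ (suc (suc a)) (x ℕ.+ y) _ ⟩
  suc (suc a) ℕ.* (x ℕ.+ y) ℕ.+ suc (suc a) ℕ.* choose (suc (suc a)) b
    ≡⟨ ≡.cong (suc (suc a) ℕ.* (x ℕ.+ y) ℕ.+_) (choose-absorb (suc a) b) ⟩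
  suc (suc a) ℕ.* (x ℕ.+ y) ℕ.+ suc (suc a ℕ.+ b) ℕ.* y
    ≡⟨ regroup a b x y ⟩
  suc a ℕ.* (x ℕ.+ y) ℕ.+ (x ℕ.+ suc (suc (suc a ℕ.+ b)) ℕ.* y)
    ≡⟨ ≡.cong (ℕ._+ (x ℕ.+ suc (suc (suc a ℕ.+ b)) ℕ.* y)) (choose-absorb a (suc b)) ⟩
  suc (a ℕ.+ suc b) ℕ.* x ℕ.+ (x ℕ.+ suc (suc (suc a ℕ.+ b)) ℕ.* y)
    ≡⟨ regroup′ a b x y ⟩
  suc (suc a ℕ.+ suc b) ℕ.* (x ℕ.+ y) ∎
  where
  open ≡.≡-Reasoning
  x = choose a (suc b)
  y = choose (suc a) b
  regroup : ∀ a b x y → suc (suc a) ℕ.* (x ℕ.+ y) ℕ.+ suc (suc a ℕ.+ b) ℕ.* y ≡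
            suc a ℕ.* (x ℕ.+ y) ℕ.+ (x ℕ.+ suc (suc (suc a ℕ.+ b)) ℕ.* y)
  regroup = ℕ-Solver.solve-∀
  regroup′ : ∀ a b x y → suc (a ℕ.+ suc b) ℕ.* x ℕ.+ (x ℕ.+ suc (suc (suc a ℕ.+ b)) ℕ.* y) ≡
             suc (suc a ℕ.+ suc b) ℕ.* (x ℕ.+ y)
  regroup′ = ℕ-Solver.solve-∀

-- Congruences modulo p and the Frobenius identity.

module Modular (p : ℕ) where
  open import Data.Integer.Base using (_+_; _*_; -_)
  open ≡ using (refl; sym; trans; cong; subst; subst₂; module ≡-Reasoning)

  infix 4 _≡ₚ_
  record _≡ₚ_ (a b : ℤ) : Set where
    constructor mod
    field p∣a-b : + p ℤ.∣ a - b
  open _≡ₚ_ public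

  ≡⇒≡ₚ : ∀ {a b} → a ≡ b → a ≡ₚ b
  ≡⇒≡ₚ {a} refl = mod (ℤ.divides 0ℤ (ℤ.+-inverseʳ a))

  private
    negate : ∀ a b → - (a - b) ≡ b - a
    negate = solve-∀
    chain : ∀ a b c → (a - b) + (b - c) ≡ a - c
    chain = solve-∀
    add : ∀ a b c d → (a - b) + (c - d) ≡ (a + c) - (b + d)
    add = solve-∀
    neg : ∀ a b → - (a - b) ≡ - a - - b
    neg = solve-∀
    mul : ∀ c a b → c * (a - b) ≡ c * a - c * b
    mul = solve-∀

  ≡ₚ-sym : ∀ {a b} → a ≡ₚ b → b ≡ₚ a
  ≡ₚ-sym {a} {b} (mod d) = mod (subst (+ p ℤ.∣_) (negate a b) (ℤ.∣m⇒∣-m d))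

  ≡ₚ-trans : ∀ {a b c} → a ≡ₚ b → b ≡ₚ c → a ≡ₚ c
  ≡ₚ-trans {a} {b} {c} (mod d) (mod e) = mod (subst (+ p ℤ.∣_) (chain a b c) (ℤ.∣m∣n⇒∣m+n d e))

  ≡ₚ-setoid : Setoid _ _
  ≡ₚ-setoid = record
    { Carrier = ℤ ; _≈_ = _≡ₚ_
    ; isEquivalence = record { refl = ≡⇒≡ₚ refl ; sym = ≡ₚ-sym ; trans = ≡ₚ-trans } }

  module ≡ₚ-Reasoning = SetoidReasoning ≡ₚ-setoid

  +-congₚ : ∀ {a b c d} → a ≡ₚ b → c ≡ₚ d → a + c ≡ₚ b + d
  +-congₚ {a} {b} {c} {d} (mod x) (mod y) = mod (subst (+ p ℤ.∣_) (add a b c d) (ℤ.∣m∣n⇒∣m+n x y))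

  +-congˡₚ : ∀ c {a b} → a ≡ₚ b → c + a ≡ₚ c + b
  +-congˡₚ c = +-congₚ (≡⇒≡ₚ (refl {x = c}))

  +-congʳₚ : ∀ c {a b} → a ≡ₚ b → a + c ≡ₚ b + c
  +-congʳₚ c e = +-congₚ e (≡⇒≡ₚ (refl {x = c}))

  neg-congₚ : ∀ {a b} → a ≡ₚ b → - a ≡ₚ - b
  neg-congₚ {a} {b} (mod x) = mod (subst (+ p ℤ.∣_) (neg a b) (ℤ.∣m⇒∣-m x))

  *-congˡₚ : ∀ c {a b} → a ≡ₚ b → c * a ≡ₚ c * b
  *-congˡₚ c {a} {b} (mod x) = mod (subst (+ p ℤ.∣_) (mul c a b) (ℤ.∣n⇒∣m*n c x))

  *-congʳₚ : ∀ c {a b} → a ≡ₚ b → a * c ≡ₚ b * c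
  *-congʳₚ c {a} {b} e = subst₂ _≡ₚ_ (ℤ.*-comm c a) (ℤ.*-comm c b) (*-congˡₚ c e)

  _≟ₚ_ : ∀ a b → Dec (a ≡ₚ b)
  a ≟ₚ b with + p ℤ.∣? a - b
  ... | yes d = yes (mod d)
  ... | no ¬d = no λ e → ¬d (p∣a-b e)

  ∣⇒≡ₚ0 : ∀ {n} → p ℕ.∣ n → + n ≡ₚ 0ℤ
  ∣⇒≡ₚ0 {n} d = mod (subst (+ p ℤ.∣_) (sym (ℤ.+-identityʳ (+ n))) (ℤ.∣ᵤ⇒∣ d))

  -- Abstracts `V i j` = the value of (1 - X)^i X^j applied to a function, for a shift X: the
  -- recurrence is multiplication by 1 = (1 - X) + X.
  Pascal : (ℕ → ℕ → ℤ) → Set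
  Pascal V = ∀ i j → V i j ≡ₚ V (suc i) j + V i (suc j)

  -- The binomial expansion along the antidiagonal from (a , b) to (a + b , 0).
  antidiagonal : (ℕ → ℕ → ℤ) → ℕ → ℕ → ℤ
  antidiagonal V a zero    = + choose a 0 * V a 0
  antidiagonal V a (suc b) = + choose a (suc b) * V a (suc b) + antidiagonal V (suc a) b

  antidiagonal-cong : ∀ {V W} → (∀ i j → V i j ≡ₚ W i j) →
                      ∀ a b → antidiagonal V a b ≡ₚ antidiagonal W a b
  antidiagonal-cong h a zero = *-congˡₚ (+ choose a 0) (h a 0)
  antidiagonal-cong h a (suc b) =
    +-congₚ (*-congˡₚ (+ choose a (suc b)) (h a (suc b))) (antidiagonal-cong h (suc a) b)

  -- Applying the recurrence to every term merges neighbouring coefficients. The first one stays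
  -- `choose a b`, since its other summand would come from the term before the start; for `a` = 0
  -- there is no such term, and the result is `antidiagonal V 0 (suc b)`.
  antidiagonal-shift : ∀ V a b →
    antidiagonal (λ i j → V (suc i) j + V i (suc j)) a b ≡
    + choose a b * V a (suc b) + antidiagonal V (suc a) b
  antidiagonal-shift V a zero rewrite choose-zeroʳ a = swap (V (suc a) 0) (V a 1)
    where
    swap : ∀ x y → 1ℤ * (x + y) ≡ 1ℤ * y + 1ℤ * x
    swap = solve-∀
  antidiagonal-shift V a (suc b) = begin
    + c * (x + y) + antidiagonal (λ i j → V (suc i) j + V i (suc j)) (suc a) b
      ≡⟨ cong (λ z → + c * (x + y) + z) (antidiagonal-shift V (suc a) b) ⟩
    + c * (x + y) + (+ c′ * x + rest)
      ≡⟨ regroup (+ c) (+ c′) x y rest ⟩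
    + c * y + ((+ c + + c′) * x + rest) ∎
    where
    open ≡-Reasoning
    c = choose a (suc b)
    c′ = choose (suc a) b
    x = V (suc a) (suc b)
    y = V a (suc (suc b))
    rest = antidiagonal V (suc (suc a)) b
    regroup : ∀ c c′ x y r → c * (x + y) + (c′ * x + r) ≡ c * y + ((c + c′) * x + r)
    regroup = solve-∀

  binomial : ∀ V → Pascal V → ∀ m → V 0 0 ≡ₚ antidiagonal V 0 m
  binomial V pas zero    = ≡⇒≡ₚ (sym (ℤ.*-identityˡ (V 0 0)))
  binomial V pas (suc m) = begin
    V 0 0 ≈⟨ binomial V pas m ⟩
    antidiagonal V 0 m ≈⟨ antidiagonal-cong pas 0 m ⟩
    antidiagonal (λ i j → V (suc i) j + V i (suc j)) 0 m ≡⟨ antidiagonal-shift V 0 m ⟩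
    antidiagonal V 0 (suc m) ∎
    where open ≡ₚ-Reasoning

  module _ (prime : Prime p) where

    -- By absorption p divides `suc a` times the coefficient, and 0 < `suc a` < p.
    choose≡ₚ0 : ∀ a b → suc a ℕ.+ suc b ≡ p → + choose (suc a) (suc b) ≡ₚ 0ℤ
    choose≡ₚ0 a b eq with euclidsLemma (suc a) (choose (suc a) (suc b)) prime
      (ℕ.divides (choose a (suc b)) (trans (choose-absorb a (suc b))
        (trans (cong (ℕ._* choose a (suc b)) eq) (ℕ.*-comm p _))))
    ... | inj₂ d = ∣⇒≡ₚ0 d
    ... | inj₁ d = contradiction (ℕ.∣⇒≤ d)
          (ℕ.<⇒≱ (subst (suc a ℕ.<_) eq (ℕ.m<m+n (suc a) ℕ.z<s)))

    antidiagonal-prime : ∀ V a b → suc a ℕ.+ b ≡ p → antidiagonal V (suc a) b ≡ₚ V p 0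
    antidiagonal-prime V a zero eq =
      ≡⇒≡ₚ (trans (ℤ.*-identityˡ _) (cong (λ k → V k 0) (trans (sym (ℕ.+-identityʳ (suc a))) eq)))
    antidiagonal-prime V a (suc b) eq = begin
      + choose (suc a) (suc b) * v + r ≈⟨ +-congₚ (*-congʳₚ v (choose≡ₚ0 a b eq))
        (antidiagonal-prime V (suc a) b (trans (sym (ℕ.+-suc (suc a) b)) eq)) ⟩
      0ℤ * v + V p 0 ≡⟨ ℤ.+-identityˡ (V p 0) ⟩
      V p 0 ∎
      where
      open ≡ₚ-Reasoning
      v = V (suc a) (suc b)
      r = antidiagonal V (suc (suc a)) b

    -- Of the expansion of 1 = ((1 - X) + X)^p only the two end terms survive modulo p.
    frobenius : ∀ V → Pascal V → V 0 0 ≡ₚ V p 0 + V 0 p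
    frobenius V pas = go p refl
      where
      -- `q` stands in for the module parameter `p`, so that matching exposes p as a successor and
      -- the first term of the expansion splits off.
      go : ∀ q → q ≡ p → V 0 0 ≡ₚ V p 0 + V 0 p
      go zero    eq = contradiction (subst Prime (sym eq) prime) ¬prime[0]
      go (suc q) refl = begin
        V 0 0 ≈⟨ binomial V pas p ⟩
        1ℤ * V 0 p + antidiagonal V 1 q
          ≈⟨ +-congₚ (≡⇒≡ₚ (ℤ.*-identityˡ (V 0 p))) (antidiagonal-prime V 0 q refl) ⟩
        V 0 p + V p 0 ≡⟨ ℤ.+-comm (V 0 p) (V p 0) ⟩
        V p 0 + V 0 p ∎
        where open ≡ₚ-Reasoning

    -- Induction on `t`: by the case `t`, sampling `V` in steps of p^t satisfies `Pascal` again, and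
    -- `frobenius` for the sample takes p such steps at once.
    frobenius^ : ∀ V → Pascal V → ∀ t a b → V a b ≡ₚ V (p ℕ.^ t ℕ.+ a) b + V a (p ℕ.^ t ℕ.+ b)
    frobenius^ V pas zero a b = pas a b
    frobenius^ V pas (suc t) a b = frobenius (λ i j → V (i ℕ.* p ℕ.^ t ℕ.+ a) (j ℕ.* p ℕ.^ t ℕ.+ b)) pas′
      where
      q = p ℕ.^ t
      pas′ : Pascal (λ i j → V (i ℕ.* q ℕ.+ a) (j ℕ.* q ℕ.+ b))
      pas′ i j = subst₂
        (λ k l → V (i ℕ.* q ℕ.+ a) (j ℕ.* q ℕ.+ b) ≡ₚ V k (j ℕ.* q ℕ.+ b) + V (i ℕ.* q ℕ.+ a) l)
        (sym (ℕ.+-assoc q (i ℕ.* q) a)) (sym (ℕ.+-assoc q (j ℕ.* q) b))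
        (frobenius^ V pas t (i ℕ.* q ℕ.+ a) (j ℕ.* q ℕ.+ b))

-- Finite sums and additive notation.

ℕ-sum : ∀ {r} → (Fin r → ℕ) → ℕ
ℕ-sum = monoidSum ℕ.+-0-monoid

ℕ-sum-updateAt : ∀ {r} (a : Fin r → ℕ) i f → ℕ-sum (updateAt a i f) ℕ.+ a i ≡ ℕ-sum a ℕ.+ f (a i)
ℕ-sum-updateAt a zero f = swap (f (a zero)) (ℕ-sum (a ∘ suc)) (a zero)
  where
  swap : ∀ x y z → x ℕ.+ y ℕ.+ z ≡ z ℕ.+ y ℕ.+ x
  swap = ℕ-Solver.solve-∀
ℕ-sum-updateAt a (suc i) f = ≡.trans (ℕ.+-assoc (a zero) _ _)
  (≡.trans (≡.cong (a zero ℕ.+_) (ℕ-sum-updateAt (a ∘ suc) i f)) (≡.sym (ℕ.+-assoc (a zero) _ _)))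

module Additive {c ℓ : Level} (G : AbelianGroup c ℓ) where
  open AbelianGroup G public renaming
    ( _∙_ to _+_; ε to 0#; _⁻¹ to -_; _-_ to _⊖_
    ; ∙-cong to +-cong; ∙-congˡ to +-congˡ; ∙-congʳ to +-congʳ; ⁻¹-cong to neg-cong
    ; assoc to +-assoc; comm to +-comm; identityˡ to +-identityˡ; identityʳ to +-identityʳ )
  open AbelianGroupProperties G public
  open CommutativeMonoidMult commutativeMonoid public renaming
    ( _×_ to _·_; ×-congˡ to ·-congˡ; ×-assocˡ to ·-assocˡ
    ; ×-homo-1 to ·-homo-1; ×-distrib-+ to ·-distrib-+ )

-- Difference operators and degrees of functions on G.

module Differences {c ℓ : Level} (G : AbelianGroup c ℓ) (p : ℕ) where
  open Additive G
  open Modular p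

  -- Elements of the group ring as coefficient functions; the coefficients are integers, read modulo
  -- p through `_≗ₚ_`.
  Fun : Set (c ⊔ ℓ)
  Fun = Func setoid (≡.setoid ℤ)

  open Func using (to; cong)

  infix 4 _≗ₚ_
  _≗ₚ_ : Fun → Fun → Set c
  f ≗ₚ h = ∀ x → to f x ≡ₚ to h x

  shift : Carrier → Fun → Fun
  shift g f = record { to = λ x → to f (x ⊖ g) ; cong = λ e → cong f (+-congʳ e) }

  infixl 6 _⊕_
  _⊕_ : Fun → Fun → Fun
  f ⊕ h = record
    { to = λ x → to f x ℤ.+ to h x ; cong = λ e → ≡.cong₂ ℤ._+_ (cong f e) (cong h e) }

  opposite : Fun → Fun
  opposite f = record { to = λ x → ℤ.- to f x ; cong = λ e → ≡.cong ℤ.-_ (cong f e) }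

  -- In the group ring `shift g` is multiplication by X^g, so this is multiplication by 1 - X^g.
  Δ : Carrier → Fun → Fun
  Δ g f = f ⊕ opposite (shift g f)

  Δ-cong : ∀ g {f h} → f ≗ₚ h → Δ g f ≗ₚ Δ g h
  Δ-cong g e x = +-congₚ (e x) (neg-congₚ (e (x ⊖ g)))

  ⊖-+ : ∀ x g h → x ⊖ (g + h) ≈ (x ⊖ g) ⊖ h
  ⊖-+ x g h = trans (+-congˡ (sym (⁻¹-∙-comm g h))) (sym (+-assoc x (- g) (- h)))

  ⊖-comm : ∀ x g h → (x ⊖ g) ⊖ h ≈ (x ⊖ h) ⊖ g
  ⊖-comm x g h = trans (sym (⊖-+ x g h))
    (trans (+-congˡ (neg-cong (+-comm g h))) (⊖-+ x h g))

  Δ-comm : ∀ g h f → Δ g (Δ h f) ≗ₚ Δ h (Δ g f)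
  Δ-comm g h f x rewrite cong f (⊖-comm x g h) =
    ≡⇒≡ₚ (regroup (to f x) (to f (x ⊖ h)) (to f (x ⊖ g)) (to f ((x ⊖ h) ⊖ g)))
    where
    regroup : ∀ x y z w → (x ℤ.+ ℤ.- y) ℤ.+ ℤ.- (z ℤ.+ ℤ.- w) ≡ (x ℤ.+ ℤ.- z) ℤ.+ ℤ.- (y ℤ.+ ℤ.- w)
    regroup = solve-∀

  -- Deg e k f says that every k-fold difference of f along steps from the family e vanishes mod p.
  data Deg {i} {I : Set i} (e : I → Carrier) : ℕ → Fun → Set (c ⊔ ℓ ⊔ i) where
    vanish : ∀ {f} → (∀ x → to f x ≡ₚ 0ℤ) → Deg e 0 f
    differ : ∀ {k f} → (∀ i → Deg e k (Δ (e i) f)) → Deg e (suc k) f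

  module _ {i} {I : Set i} {e : I → Carrier} where

    Deg-cong : ∀ {k f h} → f ≗ₚ h → Deg e k f → Deg e k h
    Deg-cong eq (vanish v) = vanish λ x → ≡ₚ-trans (≡ₚ-sym (eq x)) (v x)
    Deg-cong {f = f} {h} eq (differ d) = differ λ i → Deg-cong (Δ-cong (e i) {f} {h} eq) (d i)

    Deg-0 : ∀ k {f} → (∀ x → to f x ≡ₚ 0ℤ) → Deg e k f
    Deg-0 zero    v = vanish v
    Deg-0 (suc k) v = differ λ i → Deg-0 k λ x → +-congₚ (v x) (neg-congₚ (v (x ⊖ e i)))

    Deg-⊕ : ∀ {k f h} → Deg e k f → Deg e k h → Deg e k (f ⊕ h)
    Deg-⊕ (vanish v) (vanish w) = vanish λ x → +-congₚ (v x) (w x)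
    Deg-⊕ {f = f} {h} (differ d) (differ d′) = differ λ i → Deg-cong
      (λ x → ≡⇒≡ₚ (regroup (to f x) (to f (x ⊖ e i)) (to h x) (to h (x ⊖ e i)))) (Deg-⊕ (d i) (d′ i))
      where
      regroup : ∀ x y z w → (x ℤ.+ ℤ.- y) ℤ.+ (z ℤ.+ ℤ.- w) ≡ (x ℤ.+ z) ℤ.+ ℤ.- (y ℤ.+ w)
      regroup = solve-∀

    Deg-opposite : ∀ {k f} → Deg e k f → Deg e k (opposite f)
    Deg-opposite (vanish v) = vanish λ x → neg-congₚ (v x)
    Deg-opposite {f = f} (differ d) = differ λ i → Deg-cong
      (λ x → ≡⇒≡ₚ (ℤ.neg-distrib-+ (to f x) _)) (Deg-opposite (d i))

    Deg-shift : ∀ g {k f} → Deg e k f → Deg e k (shift g f)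
    Deg-shift g (vanish v) = vanish λ x → v (x ⊖ g)
    Deg-shift g {f = f} (differ d) = differ λ i → Deg-cong
      (λ x → ≡⇒≡ₚ (≡.cong (λ z → to f (x ⊖ g) ℤ.+ ℤ.- z) (cong f (⊖-comm x g (e i)))))
      (Deg-shift g (d i))

  data Span {i} {I : Set i} (e : I → Carrier) : Carrier → Set (c ⊔ ℓ ⊔ i) where
    gen  : ∀ i → Span e (e i)
    zero : Span e 0#
    add  : ∀ {x y} → Span e x → Span e y → Span e (x + y)
    neg  : ∀ {x} → Span e x → Span e (- x)
    resp : ∀ {x y} → x ≈ y → Span e x → Span e y

  module _ {i} {I : Set i} {e : I → Carrier} where

    Span-monotone : ∀ {j} {J : Set j} {e′ : J → Carrier} →
                    (∀ i → Span e′ (e i)) → ∀ {x} → Span e x → Span e′ x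
    Span-monotone h (gen i)    = h i
    Span-monotone h zero       = zero
    Span-monotone h (add s s′) = add (Span-monotone h s) (Span-monotone h s′)
    Span-monotone h (neg s)    = neg (Span-monotone h s)
    Span-monotone h (resp q s) = resp q (Span-monotone h s)

    -- 1 - X^(g + g′) = (1 - X^g) + X^g (1 - X^g′) and 1 - X^(-g) = -X^(-g) (1 - X^g), while `Deg`
    -- is stable under sums, negation and shifts.
    Deg-Span : ∀ {j} {J : Set j} {e′ : J → Carrier} {k f} →
               (∀ i → Deg e′ k (Δ (e i) f)) → ∀ {g} → Span e g → Deg e′ k (Δ g f)
    Deg-Span h (gen i) = h i
    Deg-Span {k = k} {f} h zero = Deg-0 k λ x → ≡⇒≡ₚ
      (≡.trans (≡.cong (λ z → to f x ℤ.+ ℤ.- z) (cong f (trans (+-congˡ ε⁻¹≈ε) (+-identityʳ x))))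
               (ℤ.+-inverseʳ (to f x)))
    Deg-Span {f = f} h (add {g} {g′} s s′) = Deg-cong
      (λ x → ≡⇒≡ₚ (≡.trans (regroup (to f x) _ _)
        (≡.cong (λ z → to f x ℤ.+ ℤ.- z) (≡.sym (cong f (⊖-+ x g g′))))))
      (Deg-⊕ (Deg-Span h s) (Deg-shift g (Deg-Span h s′)))
      where
      regroup : ∀ x y z → (x ℤ.+ ℤ.- y) ℤ.+ (y ℤ.+ ℤ.- z) ≡ x ℤ.+ ℤ.- z
      regroup = solve-∀
    Deg-Span {f = f} h (neg {g} s) = Deg-cong
      (λ x → ≡⇒≡ₚ (≡.trans (regroup (to f (x ⊖ - g)) _)
        (≡.cong (λ z → z ℤ.+ ℤ.- to f (x ⊖ - g)) (cong f (neg-cancel x g)))))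
      (Deg-opposite (Deg-shift (- g) (Deg-Span h s)))
      where
      regroup : ∀ x y → ℤ.- (x ℤ.+ ℤ.- y) ≡ y ℤ.+ ℤ.- x
      regroup = solve-∀
      neg-cancel : ∀ x g → (x ⊖ - g) ⊖ g ≈ x
      neg-cancel x g = trans (+-assoc x (- - g) (- g)) (trans (+-congˡ (inverseˡ (- g))) (+-identityʳ x))
    Deg-Span {f = f} h (resp q s) = Deg-cong
      (λ x → ≡⇒≡ₚ (≡.cong (λ z → to f x ℤ.+ ℤ.- z) (cong f (+-congˡ (neg-cong q))))) (Deg-Span h s)

    Deg-generators : (∀ x → Span e x) → ∀ {k f} → Deg e k f → Deg id k f
    Deg-generators span (vanish v) = vanish v
    Deg-generators span (differ d) = differ λ g → Deg-Span (λ i → Deg-generators span (d i)) (span g)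

  Δ^ : Carrier → ℕ → Fun → Fun
  Δ^ g zero    f = f
  Δ^ g (suc m) f = Δ g (Δ^ g m f)

  Δ^-comm : ∀ g m h f → Δ^ g m (Δ h f) ≗ₚ Δ h (Δ^ g m f)
  Δ^-comm g zero    h f x = ≡⇒≡ₚ ≡.refl
  Δ^-comm g (suc m) h f x =
    ≡ₚ-trans (Δ-cong g {Δ^ g m (Δ h f)} {Δ h (Δ^ g m f)} (Δ^-comm g m h f) x) (Δ-comm g h (Δ^ g m f) x)

  -- Pigeonhole: among more than ∑ aᵢ steps from the family e, some eᵢ occurs more than aᵢ times.
  Deg-multi-index : ∀ {r} (e : Fin r → Carrier) d (a : Fin r → ℕ) f → ℕ-sum a ≡ d →
    (∀ i x → to (Δ^ (e i) (suc (a i)) f) x ≡ₚ 0ℤ) → Deg e (suc d) f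
  Deg-multi-index {r} e d a f eq v = differ λ i → step i (a i) ≡.refl
    where
    step : ∀ i m → a i ≡ m → Deg e d (Δ (e i) f)
    -- No further step along `e i` is allowed, so `v i` already kills this difference.
    step i zero    ai≡0 = Deg-0 d (≡.subst (λ m → ∀ x → to (Δ^ (e i) (suc m) f) x ≡ₚ 0ℤ) ai≡0 (v i))
    step i (suc m) ai≡1+m = descend d eq
      where
      -- One step along `e i` has been spent, so its bound drops by one.
      a′ : Fin r → ℕ
      a′ = updateAt a i ℕ.pred
      sum-a′ : suc (ℕ-sum a′) ≡ ℕ-sum a
      sum-a′ = ℕ.+-cancelʳ-≡ m _ _ (begin
        suc (ℕ-sum a′) ℕ.+ m ≡⟨ ℕ.+-suc (ℕ-sum a′) m ⟨
        ℕ-sum a′ ℕ.+ suc m   ≡⟨ ≡.cong (ℕ-sum a′ ℕ.+_) ai≡1+m ⟨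
        ℕ-sum a′ ℕ.+ a i     ≡⟨ ℕ-sum-updateAt a i ℕ.pred ⟩
        ℕ-sum a ℕ.+ ℕ.pred (a i) ≡⟨ ≡.cong (λ z → ℕ-sum a ℕ.+ ℕ.pred z) ai≡1+m ⟩
        ℕ-sum a ℕ.+ m ∎)
        where open ≡.≡-Reasoning
      vanishes : ∀ j x → to (Δ (e i) (Δ^ (e j) (suc (a′ j)) f)) x ≡ₚ 0ℤ
      vanishes j x with j Fin.≟ i
      ... | yes ≡.refl = ≡.subst (λ m → to (Δ^ (e i) (suc m) f) x ≡ₚ 0ℤ)
        (≡.trans ai≡1+m (≡.sym (≡.cong suc (≡.trans (updateAt-updates i a) (≡.cong ℕ.pred ai≡1+m)))))
        (v i x)
      ... | no j≢i rewrite updateAt-minimal j i {ℕ.pred} a j≢i =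
        +-congₚ (v j x) (neg-congₚ (v j (x ⊖ e i)))
      descend : ∀ d → ℕ-sum a ≡ d → Deg e d (Δ (e i) f)
      descend zero    eq = contradiction (≡.trans sum-a′ eq) λ ()
      descend (suc d) eq = Deg-multi-index e d a′ (Δ (e i) f) (ℕ.suc-injective (≡.trans sum-a′ eq))
        λ j x → ≡ₚ-trans (Δ^-comm (e j) (suc (a′ j)) (e i) f x) (vanishes j x)

  module _ (prime : Prime p) where

    -- With q = p^t, `frobenius^` for (1 - X^g)^i X^(jg) f gives f(x) = (1 - X^g)^q f(x) + f(x - qg)
    -- modulo p, and qg = 0 makes the last term f(x).
    Δ^-nilpotent : ∀ t g → (p ℕ.^ t) · g ≈ 0# → ∀ f x → to (Δ^ g (p ℕ.^ t) f) x ≡ₚ 0ℤ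
    Δ^-nilpotent t g q f x = begin
      to (Δ^ g (p ℕ.^ t) f) x                ≡⟨ cong (Δ^ g (p ℕ.^ t) f) x-0 ⟨
      to (Δ^ g (p ℕ.^ t) f) (x ⊖ 0#)         ≡⟨ ≡.cong (λ m → to (Δ^ g m f) (x ⊖ 0#)) (ℕ.+-identityʳ (p ℕ.^ t)) ⟨
      V (p ℕ.^ t ℕ.+ 0) 0                    ≡⟨ add-sub (V (p ℕ.^ t ℕ.+ 0) 0) (to f x) ⟩
      (V (p ℕ.^ t ℕ.+ 0) 0 ℤ.+ to f x) ℤ.- to f x
        ≡⟨ ≡.cong (λ z → (V (p ℕ.^ t ℕ.+ 0) 0 ℤ.+ z) ℤ.- to f x)
             (cong f (trans (+-congˡ (neg-cong (trans (·-congˡ (ℕ.+-identityʳ (p ℕ.^ t))) q))) x-0)) ⟨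
      (V (p ℕ.^ t ℕ.+ 0) 0 ℤ.+ V 0 (p ℕ.^ t ℕ.+ 0)) ℤ.- to f x
        ≈⟨ +-congʳₚ (ℤ.- to f x) (frobenius^ prime V pascal t 0 0) ⟨
      V 0 0 ℤ.- to f x                       ≡⟨ ≡.cong (ℤ._- to f x) (cong f x-0) ⟩
      to f x ℤ.- to f x                      ≡⟨ ℤ.+-inverseʳ (to f x) ⟩
      0ℤ ∎
      where
      open ≡ₚ-Reasoning
      V : ℕ → ℕ → ℤ
      V i j = to (Δ^ g i f) (x ⊖ (j · g))
      x-0 : x ⊖ 0# ≈ x
      x-0 = trans (+-congˡ ε⁻¹≈ε) (+-identityʳ x)
      sub-add : ∀ a b → a ≡ (a ℤ.+ ℤ.- b) ℤ.+ b
      sub-add = solve-∀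
      add-sub : ∀ a b → a ≡ (a ℤ.+ b) ℤ.- b
      add-sub = solve-∀
      pascal : Pascal V
      pascal i j rewrite cong (Δ^ g i f) (trans (⊖-+ x g (j · g)) (⊖-comm x g (j · g))) =
        ≡⇒≡ₚ (sub-add (V i j) _)

    Deg-all : ∀ {r} (e : Fin r → Carrier) (t : Fin r → ℕ) → (∀ x → Span e x) →
      (∀ i → (p ℕ.^ t i) · e i ≈ 0#) → ∀ f → Deg id (suc (ℕ-sum (λ i → ℕ.pred (p ℕ.^ t i)))) f
    Deg-all e t span q f = Deg-generators span (Deg-multi-index e _ _ f ≡.refl
      λ i x → ≡.subst (λ m → to (Δ^ (e i) m f) x ≡ₚ 0ℤ) (≡.sym (ℕ.suc-pred (p ℕ.^ t i) {{nz i}}))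
        (Δ^-nilpotent (t i) (e i) (q i) f x))
      where
      nz : ∀ i → ℕ.NonZero (p ℕ.^ t i)
      nz i = ℕ.m^n≢0 p (t i) {{prime⇒nonZero prime}}

-- Independent generators of a finite abelian p-group.

-- Exhaustive search, one coordinate at a time. A function agrees with its head put before its tail
-- only pointwise, hence `resp`.
bounded? : ∀ {q r} (B : Fin r → ℕ) {P : (Fin r → ℕ) → Set q} → (∀ {a b} → a ≗ b → P a → P b) →
           (∀ a → Dec (P a)) → Dec (∃[ a ] ((∀ i → a i < B i) × P a))
bounded? {r = zero} B resp P? = map′
  (λ Pa → Vector.[] , (λ ()) , Pa) (λ (a , _ , Pa) → resp (λ ()) Pa) (P? Vector.[])
bounded? {r = suc r} B {P} resp P? = map′
  (λ { (k , k<B , a , a<B , Pa) → k Vector.∷ a , (λ { zero → k<B ; (suc i) → a<B i }) , Pa })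
  (λ { (a , a<B , Pa) → a zero , a<B zero , a ∘ suc , a<B ∘ suc ,
    resp (λ { zero → ≡.refl ; (suc i) → ≡.refl }) Pa })
  (ℕ.anyUpTo? (λ k → bounded? (B ∘ suc) {P ∘ (k Vector.∷_)}
    (λ e → resp λ { zero → ≡.refl ; (suc i) → e i }) (λ a → P? (k Vector.∷ a))) (B zero))

module _ {p : ℕ} (prime : Prime p) where

  prime∤⇒coprime : ∀ {b} → ¬ p ∣ b → Coprime p b
  prime∤⇒coprime ∤b (d∣p , d∣b) with prime⇒irreducible prime d∣p
  ... | inj₁ d≡1    = d≡1
  ... | inj₂ ≡.refl = contradiction d∣b ∤b

  -- Divide all entries by p as long as p divides them all; the nonzero entry `a i` shrinks each
  -- time, so this stops.
  primitive-part : ∀ {r} (a : Fin r → ℕ) i → a i ≢ 0 →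
    ∃[ s ] Σ[ b ∈ (Fin r → ℕ) ] ((∀ k → a k ≡ p ℕ.^ s ℕ.* b k) × Σ[ j ∈ Fin r ] ¬ p ∣ b j)
  primitive-part {r} a i = go (a i) a ℕ.≤-refl
    where
    instance _ = prime⇒nonTrivial prime
    go : ∀ m (a : Fin r → ℕ) → a i ≤ m → a i ≢ 0 →
         ∃[ s ] Σ[ b ∈ (Fin r → ℕ) ] ((∀ k → a k ≡ p ℕ.^ s ℕ.* b k) × Σ[ j ∈ Fin r ] ¬ p ∣ b j)
    go zero    a ai≤m ai≢0 = contradiction (ℕ.n≤0⇒n≡0 ai≤m) ai≢0
    go (suc m) a ai≤m ai≢0 with Fin.all? (λ k → p ∣? a k)
    ... | no ¬all = 0 , a , (λ k → ≡.sym (ℕ.*-identityˡ (a k))) , Fin.¬∀⟶∃¬ r _ (λ k → p ∣? a k) ¬all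
    ... | yes all = suc s , b , (λ k → ≡.trans (a≡ k) (≡.trans (≡.cong (ℕ._* p) (b≡ k)) (swap k))) , j , ∤bj
      where
      a′ : Fin r → ℕ
      a′ k = quotient (all k)
      a≡ : ∀ k → a k ≡ a′ k ℕ.* p
      a≡ k = ℕ.m∣n⇒n≡quotient*m (all k)
      a′i≢0 : a′ i ≢ 0
      a′i≢0 eq = ai≢0 (≡.trans (a≡ i) (≡.cong (ℕ._* p) eq))
      a′i<ai : a′ i < a i
      a′i<ai = ≡.subst (a′ i <_) (≡.sym (a≡ i))
        (ℕ.m<m*n (a′ i) p {{ℕ.≢-nonZero a′i≢0}} (ℕ.nonTrivial⇒n>1 p))
      rec = go m a′ (ℕ.s≤s⁻¹ (ℕ.<-≤-trans a′i<ai ai≤m)) a′i≢0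
      s = proj₁ rec
      b = proj₁ (proj₂ rec)
      b≡ = proj₁ (proj₂ (proj₂ rec))
      j = proj₁ (proj₂ (proj₂ (proj₂ rec)))
      ∤bj = proj₂ (proj₂ (proj₂ (proj₂ rec)))
      swap : ∀ k → p ℕ.^ s ℕ.* b k ℕ.* p ≡ p ℕ.* p ℕ.^ s ℕ.* b k
      swap k = ≡.trans (ℕ.*-comm _ p) (≡.sym (ℕ.*-assoc p (p ℕ.^ s) (b k)))

module Structure {c ℓ : Level} (G : AbelianGroup c ℓ) {p : ℕ} (prime : Prime p)
                 {n : ℕ} (order : HasOrder G n) where
  open Additive G
  open CommutativeMonoidSum commutativeMonoid
    using (sum-remove; sum-cong-≋; sum-permute; ∑-distrib-+; sum-replicate) renaming (sum to ∑)
  open Differences G p using (Span; gen; zero; add; neg; resp; Span-monotone)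
  open Inverse order using (to; from; to-cong; strictlyInverseˡ; strictlyInverseʳ)
  open import Relation.Binary.Reasoning.Setoid setoid

  infix 4 _≟_
  _≟_ : ∀ x y → Dec (x ≈ y)
  x ≟ y = map′
    (λ eq → trans (sym (strictlyInverseʳ x)) (trans (Inverse.from-cong order eq) (strictlyInverseʳ y)))
    to-cong (to x Fin.≟ to y)

  -- Translation by x permutes G, so the sum over G is unchanged by adding n · x to it.
  order·x≈0 : ∀ x → n · x ≈ 0#
  order·x≈0 x = identityʳ-unique (∑ from) (n · x) (sym (begin
    ∑ from ≈⟨ sum-permute from π ⟩
    ∑ (λ i → from (to (from i + x))) ≈⟨ sum-cong-≋ (λ i → strictlyInverseʳ (from i + x)) ⟩
    ∑ (λ i → from i + x) ≈⟨ ∑-distrib-+ from (const x) ⟩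
    ∑ from + ∑ {n} (const x) ≈⟨ +-congˡ (sum-replicate n) ⟩
    ∑ from + n · x ∎))
    where
    cancel : ∀ u v i → u + v ≈ 0# → to (from (to (from i + u)) + v) ≡ i
    cancel u v i eq = ≡.trans (to-cong (begin
      from (to (from i + u)) + v ≈⟨ +-congʳ (strictlyInverseʳ (from i + u)) ⟩
      (from i + u) + v ≈⟨ +-assoc (from i) u v ⟩
      from i + (u + v) ≈⟨ +-congˡ eq ⟩
      from i + 0# ≈⟨ +-identityʳ (from i) ⟩
      from i ∎)) (strictlyInverseˡ i)
    π = permutation (λ i → to (from i + x)) (λ i → to (from i ⊖ x))
      (λ i → cancel (- x) x i (inverseˡ x)) (λ i → cancel x (- x) i (inverseʳ x))

  linear : ∀ {r} → (Fin r → ℕ) → (Fin r → Carrier) → Carrier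
  linear a e = ∑ (λ i → a i · e i)

  ·-linear : ∀ {r} m (a : Fin r → ℕ) e → m · linear a e ≈ linear (λ i → m ℕ.* a i) e
  ·-linear {zero}  m a e = zero-multiple m
    where
    zero-multiple : ∀ m → m · 0# ≈ 0#
    zero-multiple zero    = refl
    zero-multiple (suc m) = trans (+-identityˡ _) (zero-multiple m)
  ·-linear {suc r} m a e = trans (·-distrib-+ _ _ m)
    (+-cong (·-assocˡ (e zero) m (a zero)) (·-linear m (a ∘ suc) (e ∘ suc)))

  module _ {i} {I : Set i} {e : I → Carrier} where

    Span-· : ∀ m {x} → Span e x → Span e (m · x)
    Span-· zero    s = zero
    Span-· (suc m) s = add s (Span-· m s)

    Span-∑ : ∀ {r} (f : Fin r → Carrier) → (∀ k → Span e (f k)) → Span e (∑ f)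
    Span-∑ {zero}  f s = zero
    Span-∑ {suc r} f s = add (s zero) (Span-∑ (f ∘ suc) (s ∘ suc))

    Span-isolate : ∀ {r} (f : Fin r → Carrier) j → Span e (∑ f) →
                   (∀ k → k ≢ j → Span e (f k)) → Span e (f j)
    Span-isolate {suc r} f j s others = resp (begin
      ∑ f ⊖ ∑ rest                ≈⟨ +-congʳ (sum-remove {i = j} f) ⟩
      (f j + ∑ rest) ⊖ ∑ rest     ≈⟨ +-assoc _ _ _ ⟩
      f j + (∑ rest ⊖ ∑ rest)     ≈⟨ +-congˡ (inverseʳ _) ⟩
      f j + 0#                    ≈⟨ +-identityʳ _ ⟩
      f j ∎)
      (add s (neg (Span-∑ rest λ k → others (punchIn j k) (Fin.punchInᵢ≢i j k))))
      where rest = f ∘ punchIn j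

    Span-Bézout : ∀ {a b x} u v → 1 ℕ.+ v ℕ.* b ≡ u ℕ.* a → Span e (a · x) → Span e (b · x) → Span e x
    Span-Bézout {a} {b} {x} u v eq s s′ = resp (begin
      u · (a · x) ⊖ v · (b · x)         ≈⟨ +-cong (·-assocˡ x u a) (neg-cong (·-assocˡ x v b)) ⟩
      (u ℕ.* a) · x ⊖ (v ℕ.* b) · x     ≈⟨ +-congʳ (·-congˡ eq) ⟨
      (x + (v ℕ.* b) · x) ⊖ (v ℕ.* b) · x ≈⟨ +-assoc _ _ _ ⟩
      x + ((v ℕ.* b) · x ⊖ (v ℕ.* b) · x) ≈⟨ +-congˡ (inverseʳ _) ⟩
      x + 0# ≈⟨ +-identityʳ x ⟩
      x ∎)
      (add (Span-· u s) (neg (Span-· v s′)))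

    -- Induction on `t`: the hypotheses pass to `p · x` with exponent one less, so `p · x` lies in
    -- the span, and Bézout combines it with `b · x` to give `x`.
    Span-coprime : ∀ t {b x} → ¬ p ∣ b → Span e (b · x) → Span e ((p ℕ.^ t) · x) → Span e x
    Span-coprime zero    ∤b s s′ = resp (·-homo-1 _) s′
    Span-coprime (suc t) {b} {x} ∤b s s′ = bézout (coprime-Bézout (prime∤⇒coprime prime ∤b))
      where
      sp : Span e (p · x)
      sp = Span-coprime t ∤b
        (resp (trans (·-assocˡ x p b) (trans (·-congˡ (ℕ.*-comm p b)) (sym (·-assocˡ x b p)))) (Span-· p s))
        (resp (trans (·-congˡ (ℕ.*-comm p (p ℕ.^ t))) (sym (·-assocˡ x (p ℕ.^ t) p))) s′)
      bézout : Bézout.Identity 1 p b → Span e x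
      bézout (Bézout.+- u v eq) = Span-Bézout u v eq sp s
      bézout (Bézout.-+ u v eq) = Span-Bézout v u eq s sp

  -- `t` only bounds the orders, and zero generators with exponent 0 are allowed, so that `r` can
  -- stay fixed while generators are replaced.
  record Generators (r : ℕ) : Set (c ⊔ ℓ) where
    field
      e       : Fin r → Carrier
      t       : Fin r → ℕ
      span    : ∀ x → Span e x
      torsion : ∀ i → (p ℕ.^ t i) · e i ≈ 0#
  open Generators

  Relation : ∀ {r} → Generators r → (Fin r → ℕ) → Set ℓ
  Relation E a = linear a (e E) ≈ 0# × ∃[ i ] a i ≢ 0

  -- Together with `span` and `torsion` this says that G is the direct sum of cyclic groups of
  -- orders p^tᵢ generated by the eᵢ.
  Independent : ∀ {r} → Generators r → Set ℓ
  Independent {r} E = ¬ (∃[ a ] ((∀ i → a i < p ℕ.^ t E i) × Relation E a))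

  module _ {r} (E : Generators r) where

    relation? : Dec (∃[ a ] ((∀ i → a i < p ℕ.^ t E i) × Relation E a))
    relation? = bounded? (λ i → p ℕ.^ t E i)
      (λ a≗b (lin , i , ai≢0) → trans (sum-cong-≋ (λ i → ·-congˡ (≡.sym (a≗b i)))) lin ,
        i , ≡.subst (_≢ 0) (a≗b i) ai≢0)
      (λ a → (linear a (e E) ≟ 0#) ×-dec Fin.any? (λ i → ¬? (a i ℕ.≟ 0)))

    -- A relation p^s Σ bᵢ eᵢ = 0 with p ∤ bⱼ lets y = Σ bᵢ eᵢ, which is killed by p^s, replace eⱼ.
    module Replace (s : ℕ) (b : Fin r → ℕ) (j : Fin r) (∤bj : ¬ p ∣ b j)
                   (p^s·y : (p ℕ.^ s) · linear b (e E) ≈ 0#) where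

      y : Carrier
      y = linear b (e E)

      e′ : Fin r → Carrier
      e′ = updateAt (e E) j (const y)

      t′ : Fin r → ℕ
      t′ = updateAt (t E) j (const s)

      torsion′ : ∀ k → (p ℕ.^ t′ k) · e′ k ≈ 0#
      torsion′ k with k Fin.≟ j
      ... | yes ≡.refl rewrite updateAt-updates j {const s} (t E)
                             | updateAt-updates j {const y} (e E) = p^s·y
      ... | no k≢j rewrite updateAt-minimal k j {const s} (t E) k≢j
                         | updateAt-minimal k j {const y} (e E) k≢j = torsion E k

      other : ∀ k → k ≢ j → Span e′ (e E k)
      other k k≢j = resp (reflexive (updateAt-minimal k j (e E) k≢j)) (gen k)

      replaced : ∀ k → Span e′ (e E k)
      replaced k with k Fin.≟ j
      ... | no k≢j = other k k≢j
      -- bⱼ eⱼ is y minus the other terms and p^tⱼ eⱼ = 0, so p ∤ bⱼ recovers eⱼ.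
      ... | yes ≡.refl = Span-coprime (t E j) ∤bj
              (Span-isolate (λ k → b k · e E k) j (resp (reflexive (updateAt-updates j (e E))) (gen j))
                (λ k k≢j → Span-· (b k) (other k k≢j)))
              (resp (sym (torsion E j)) zero)

      generators : Generators r
      generators = record
        { e = e′ ; t = t′ ; span = λ x → Span-monotone replaced (span E x) ; torsion = torsion′ }

      decreases : s < t E j → ℕ-sum t′ < ℕ-sum (t E)
      decreases s<tj = ℕ.+-cancelʳ-< (t E j) _ _
        (≡.subst (_< ℕ-sum (t E) ℕ.+ t E j) (≡.sym (ℕ-sum-updateAt (t E) j (const s)))
          (ℕ.+-monoʳ-< (ℕ-sum (t E)) s<tj))

    -- After extracting the largest common power p^s from the relation, p^s ≤ p^s bⱼ = aⱼ < p^tⱼ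
    -- forces s < tⱼ, so the replacement lowers the total exponent.
    reduce : ∀ {a} → (∀ i → a i < p ℕ.^ t E i) → Relation E a → ∃[ E′ ] ℕ-sum (t {r} E′) < ℕ-sum (t E)
    reduce {a} a<p^t (lin , i , ai≢0) with primitive-part prime a i ai≢0
    ... | s , b , a≡p^sb , j , ∤bj = generators , decreases (ℕ.≰⇒> λ tj≤s → ℕ.<⇒≱ (a<p^t j)
        (ℕ.≤-trans (ℕ.^-monoʳ-≤ p {{prime⇒nonZero prime}} tj≤s)
        (ℕ.≤-trans (ℕ.m≤m*n (p ℕ.^ s) (b j) {{ℕ.≢-nonZero bj≢0}}) (ℕ.≤-reflexive (≡.sym (a≡p^sb j))))))
      where
      open Replace s b j ∤bj (trans (·-linear (p ℕ.^ s) b (e E))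
        (trans (sum-cong-≋ (λ k → ·-congˡ (≡.sym (a≡p^sb k)))) lin))
      bj≢0 : b j ≢ 0
      bj≢0 bj≡0 = ∤bj (≡.subst (p ∣_) (≡.sym bj≡0) (p ∣0))

  -- Descent on the total exponent: each relation found permits a replacement, so eventually none is
  -- left.
  independent-generators : ∀ {r} → Generators r → ∃[ E ] Independent {r} E
  independent-generators {r} E = go (ℕ-sum (t E)) E ℕ.≤-refl
    where
    go : ∀ m E → ℕ-sum (t E) ≤ m → ∃[ E ] Independent {r} E
    go m E ≤m with relation? E
    ... | no ind = E , ind
    go zero E ≤m | yes (a , a< , rel) = contradiction (ℕ.<-≤-trans (proj₂ (reduce E a< rel)) ≤m) ℕ.n≮0
    go (suc m) E ≤m | yes (a , a< , rel) =
      go m (proj₁ (reduce E a< rel)) (ℕ.s≤s⁻¹ (ℕ.<-≤-trans (proj₂ (reduce E a< rel)) ≤m))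

  -- A crude start for the descent: all of G generates, and every element is killed by the group
  -- order.
  all-elements : ∀ {k} → n ≡ p ℕ.^ k → Generators n
  all-elements {k} n≡p^k = record
    { e = from ; t = const k
    ; span = λ x → resp (strictlyInverseʳ x) (gen (to x))
    ; torsion = λ i → trans (·-congˡ (≡.sym n≡p^k)) (order·x≈0 (from i)) }

-- Residues and inverses modulo p.

module Residues {p : ℕ} (prime : Prime p) where
  open Modular p
  private instance
    _ = prime⇒nonZero prime
    _ = prime⇒nonTrivial prime

  ≡ₚ0⇒∣ : ∀ {m} → + m ≡ₚ 0ℤ → p ∣ m
  ≡ₚ0⇒∣ {m} (mod d) = ℤ.∣⇒∣ᵤ (≡.subst (+ p ℤ.∣_) (ℤ.+-identityʳ (+ m)) d)

  1≢ₚ0 : ¬ 1ℤ ≡ₚ 0ℤ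
  1≢ₚ0 e = ℕ.>⇒∤ (ℕ.nonTrivial⇒n>1 p) (≡ₚ0⇒∣ e)

  <⇒≢ₚ : ∀ {i j} → i < j → j < p → ¬ + j ≡ₚ + i
  <⇒≢ₚ {i} {j} i<j j<p (mod d) = ℕ.>⇒∤ {{ℕ.>-nonZero (ℕ.m<n⇒0<n∸m i<j)}}
    (ℕ.≤-<-trans (ℕ.m∸n≤m j i) j<p)
    (ℤ.∣⇒∣ᵤ (≡.subst (+ p ℤ.∣_) (≡.trans (ℤ.m-n≡m⊖n j i) (ℤ.⊖-≥ (ℕ.<⇒≤ i<j))) d))

  residue-unique : ∀ {i j} → i < p → j < p → + i ≡ₚ + j → i ≡ j
  residue-unique {i} {j} i<p j<p e with ℕ.<-cmp i j
  ... | tri< i<j _ _ = contradiction (≡ₚ-sym e) (<⇒≢ₚ i<j j<p)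
  ... | tri≈ _ i≡j _ = i≡j
  ... | tri> _ _ j<i = contradiction e (<⇒≢ₚ j<i i<p)

  ≡ₚ-residue : ∀ a → a ≡ₚ + (a %ℕ p)
  ≡ₚ-residue a = mod (ℤ.divides (a /ℕ p)
    (≡.trans (≡.cong (ℤ._- + (a %ℕ p)) (a≡a%ℕn+[a/ℕn]*n a p)) (cancel (+ (a %ℕ p)) _)))
    where
    cancel : ∀ r q → (r ℤ.+ q) ℤ.- r ≡ q
    cancel = solve-∀

  residue : ℤ → Fin p
  residue a = fromℕ< (n%ℕd<d a p)

  residue-cong : ∀ {a b} → a ≡ₚ b → residue a ≡ residue b
  residue-cong {a} {b} e = Fin.fromℕ<-cong _ _ (residue-unique (n%ℕd<d a p) (n%ℕd<d b p)
    (≡ₚ-trans (≡ₚ-sym (≡ₚ-residue a)) (≡ₚ-trans e (≡ₚ-residue b)))) _ _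

  toℕ-residue : ∀ a → + toℕ (residue a) ≡ₚ a
  toℕ-residue a = ≡ₚ-trans (≡⇒≡ₚ (≡.cong +_ (Fin.toℕ-fromℕ< (n%ℕd<d a p)))) (≡ₚ-sym (≡ₚ-residue a))

  residue-toℕ : ∀ i → residue (+ toℕ i) ≡ i
  residue-toℕ i = Fin.toℕ-injective (residue-unique (Fin.toℕ<n _) (Fin.toℕ<n i) (toℕ-residue (+ toℕ i)))

  -- The inverse is sought in ℕ, so that it can serve as a multiple of a group element.
  invert : ∀ a → ¬ a ≡ₚ 0ℤ → ∃[ m ] + m ℤ.* a ≡ₚ 1ℤ
  invert a a≢0 = bézout
    (coprime-Bézout (prime∤⇒coprime prime λ d → a≢0 (≡ₚ-trans (≡ₚ-residue a) (∣⇒≡ₚ0 d))))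
    where
    open ≡ₚ-Reasoning
    r = a %ℕ p
    bézout : Bézout.Identity 1 p r → ∃[ m ] + m ℤ.* a ≡ₚ 1ℤ
    bézout (Bézout.-+ u v eq) = v , (begin
      + v ℤ.* a           ≈⟨ *-congˡₚ (+ v) (≡ₚ-residue a) ⟩
      + v ℤ.* + r         ≡⟨ ℤ.pos-* v r ⟨
      + (v ℕ.* r)         ≡⟨ ≡.cong +_ eq ⟨
      1ℤ ℤ.+ + (u ℕ.* p)  ≈⟨ +-congˡₚ 1ℤ (∣⇒≡ₚ0 (n∣m*n u)) ⟩
      1ℤ ∎)
    -- Here 1 + v r = u p, so the inverse is -v, replaced by its residue.
    bézout (Bézout.+- u v eq) = toℕ (residue (ℤ.- + v)) , (begin
      + toℕ (residue (ℤ.- + v)) ℤ.* a ≈⟨ *-congʳₚ a (toℕ-residue (ℤ.- + v)) ⟩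
      ℤ.- + v ℤ.* a           ≈⟨ *-congˡₚ (ℤ.- + v) (≡ₚ-residue a) ⟩
      ℤ.- + v ℤ.* + r         ≡⟨ expand (+ v) (+ r) ⟩
      1ℤ ℤ.- (1ℤ ℤ.+ + v ℤ.* + r) ≡⟨ ≡.cong (λ z → 1ℤ ℤ.- (1ℤ ℤ.+ z)) (ℤ.pos-* v r) ⟨
      1ℤ ℤ.- + (1 ℕ.+ v ℕ.* r) ≡⟨ ≡.cong (λ z → 1ℤ ℤ.- + z) eq ⟩
      1ℤ ℤ.- + (u ℕ.* p)      ≈⟨ +-congˡₚ 1ℤ (neg-congₚ (∣⇒≡ₚ0 (n∣m*n u))) ⟩
      1ℤ ∎)
      where
      expand : ∀ v r → ℤ.- v ℤ.* r ≡ 1ℤ ℤ.- (1ℤ ℤ.+ v ℤ.* r)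
      expand = solve-∀

-- Affine functions to 𝔽ₚ and their zero sets.

module AffineFunctions {c ℓ : Level} (G : AbelianGroup c ℓ) {p : ℕ} (prime : Prime p) where
  open Additive G
  open Differences G p
  open Modular p
  open Residues prime
  open Func using (to; cong)

  record Affine (f : Fun) : Set c where
    field
      at-0 : to f 0# ≡ₚ 1ℤ
      at-+ : ∀ x y → to f (x + y) ℤ.+ 1ℤ ≡ₚ to f x ℤ.+ to f y

  -- The second difference of f along x and y, taken at x + y, is f(x + y) - f(x) - f(y) + f(0).
  Deg-2⇒affine : ∀ {f} → Deg id 2 f → to f 0# ≡ₚ 1ℤ → Affine f
  Deg-2⇒affine {f} (differ d) f0 = record { at-0 = f0 ; at-+ = λ x y → second-difference x y (d x) }
    where
    open ≡ₚ-Reasoning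
    second-difference : ∀ x y → Deg id 1 (Δ x f) → to f (x + y) ℤ.+ 1ℤ ≡ₚ to f x ℤ.+ to f y
    second-difference x y (differ d) with d y
    ... | vanish v = begin
      u ℤ.+ 1ℤ ≈⟨ +-congˡₚ u f0 ⟨
      u ℤ.+ z ≡⟨ regroup u (to f x) (to f y) z ⟩
      ((u ℤ.+ ℤ.- to f y) ℤ.+ ℤ.- (to f x ℤ.+ ℤ.- z)) ℤ.+ (to f x ℤ.+ to f y)
        ≡⟨ ≡.cong (ℤ._+ (to f x ℤ.+ to f y)) (≡.cong₂ (λ a b → (u ℤ.+ ℤ.- a) ℤ.+ ℤ.- b)
             (cong f (xyx⁻¹≈y x y)) (≡.cong₂ (λ a b → a ℤ.+ ℤ.- b)
               (cong f x+y-y) (cong f (trans (+-congʳ x+y-y) (inverseʳ x))))) ⟨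
      to (Δ y (Δ x f)) (x + y) ℤ.+ (to f x ℤ.+ to f y) ≈⟨ +-congʳₚ (to f x ℤ.+ to f y) (v (x + y)) ⟩
      0ℤ ℤ.+ (to f x ℤ.+ to f y) ≡⟨ ℤ.+-identityˡ _ ⟩
      to f x ℤ.+ to f y ∎
      where
      u = to f (x + y)
      z = to f 0#
      x+y-y : (x + y) ⊖ y ≈ x
      x+y-y = trans (+-assoc x y (- y)) (trans (+-congˡ (inverseʳ y)) (+-identityʳ x))
      regroup : ∀ u a b z → u ℤ.+ z ≡ ((u ℤ.+ ℤ.- b) ℤ.+ ℤ.- (a ℤ.+ ℤ.- z)) ℤ.+ (a ℤ.+ b)
      regroup = solve-∀

  -- An affine f is 1 + φ for a homomorphism φ to ℤ/p; when φ ≠ 0 the zeros of f form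
  -- the coset of ker φ on which φ = -1.
  module Kernel {f : Fun} (affine : Affine f) {x₀ : Carrier} (nonconstant : ¬ to f x₀ ≡ₚ 1ℤ) where
    open Affine affine
    open ≡ₚ-Reasoning

    φ : Carrier → ℤ
    φ x = to f x ℤ.- 1ℤ

    φ-cong : ∀ {x y} → x ≈ y → φ x ≡ₚ φ y
    φ-cong e = ≡⇒≡ₚ (≡.cong (ℤ._- 1ℤ) (cong f e))

    φ-0 : φ 0# ≡ₚ 0ℤ
    φ-0 = +-congʳₚ (ℤ.- 1ℤ) at-0

    φ-+ : ∀ x y → φ (x + y) ≡ₚ φ x ℤ.+ φ y
    φ-+ x y = begin
      to f (x + y) ℤ.- 1ℤ ≡⟨ left (to f (x + y)) ⟩
      (to f (x + y) ℤ.+ 1ℤ) ℤ.+ ℤ.- (1ℤ ℤ.+ 1ℤ) ≈⟨ +-congʳₚ (ℤ.- (1ℤ ℤ.+ 1ℤ)) (at-+ x y) ⟩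
      (to f x ℤ.+ to f y) ℤ.+ ℤ.- (1ℤ ℤ.+ 1ℤ) ≡⟨ right (to f x) (to f y) ⟩
      φ x ℤ.+ φ y ∎
      where
      left : ∀ a → a ℤ.- 1ℤ ≡ (a ℤ.+ 1ℤ) ℤ.+ ℤ.- (1ℤ ℤ.+ 1ℤ)
      left = solve-∀
      right : ∀ a b → (a ℤ.+ b) ℤ.+ ℤ.- (1ℤ ℤ.+ 1ℤ) ≡ (a ℤ.- 1ℤ) ℤ.+ (b ℤ.- 1ℤ)
      right = solve-∀

    φ-neg : ∀ x → φ (- x) ≡ₚ ℤ.- φ x
    φ-neg x = begin
      φ (- x)                          ≡⟨ expand (φ (- x)) (φ x) ⟩
      (φ (- x) ℤ.+ φ x) ℤ.+ ℤ.- φ x    ≈⟨ +-congʳₚ (ℤ.- φ x) (φ-+ (- x) x) ⟨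
      φ (- x + x) ℤ.+ ℤ.- φ x          ≈⟨ +-congʳₚ (ℤ.- φ x) (≡ₚ-trans (φ-cong (inverseˡ x)) φ-0) ⟩
      0ℤ ℤ.+ ℤ.- φ x                   ≡⟨ ℤ.+-identityˡ _ ⟩
      ℤ.- φ x ∎
      where
      expand : ∀ a b → a ≡ (a ℤ.+ b) ℤ.+ ℤ.- b
      expand = solve-∀

    φ-· : ∀ m x → φ (m · x) ≡ₚ + m ℤ.* φ x
    φ-· zero    x = φ-0
    φ-· (suc m) x = begin
      φ (x + m · x)          ≈⟨ φ-+ x (m · x) ⟩
      φ x ℤ.+ φ (m · x)      ≈⟨ +-congˡₚ (φ x) (φ-· m x) ⟩
      φ x ℤ.+ + m ℤ.* φ x    ≡⟨ ℤ.suc-* (+ m) (φ x) ⟨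
      + suc m ℤ.* φ x ∎

    kernel : Subgroup G
    kernel = record
      { ⟦_⟧      = λ x → Lift ℓ (φ x ≡ₚ 0ℤ)
      ; resp     = λ e (lift k) → lift (≡ₚ-trans (φ-cong (sym e)) k)
      ; 0#-mem   = lift φ-0
      ; +-closed = λ {x} {y} (lift k) (lift k′) → lift (≡ₚ-trans (φ-+ x y) (+-congₚ k k′))
      ; neg-mem  = λ {x} (lift k) → lift (≡ₚ-trans (φ-neg x) (neg-congₚ k))
      }

    φ-nonzero : ¬ φ x₀ ≡ₚ 0ℤ
    φ-nonzero e = nonconstant (begin
      to f x₀          ≡⟨ expand (to f x₀) ⟩
      φ x₀ ℤ.+ 1ℤ      ≈⟨ +-congʳₚ 1ℤ e ⟩
      1ℤ ∎)
      where
      expand : ∀ a → a ≡ (a ℤ.- 1ℤ) ℤ.+ 1ℤ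
      expand = solve-∀

    m₀ : ℕ
    m₀ = proj₁ (invert (φ x₀) φ-nonzero)

    -- A preimage of 1 under φ: its multiples represent the cosets of the kernel, and -β is a point
    -- where φ = -1.
    β : Carrier
    β = m₀ · x₀

    φ-β : φ β ≡ₚ 1ℤ
    φ-β = ≡ₚ-trans (φ-· m₀ x₀) (proj₂ (invert (φ x₀) φ-nonzero))

    φ-·β : ∀ m → φ (m · β) ≡ₚ + m
    φ-·β m = ≡ₚ-trans (φ-· m β) (≡ₚ-trans (*-congˡₚ (+ m) φ-β) (≡⇒≡ₚ (ℤ.*-identityʳ (+ m))))

    φ-⊖ : ∀ {x y} → φ x ≡ₚ φ y → φ (x ⊖ y) ≡ₚ 0ℤ
    φ-⊖ {x} {y} e = begin
      φ (x ⊖ y)           ≈⟨ φ-+ x (- y) ⟩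
      φ x ℤ.+ φ (- y)     ≈⟨ +-congₚ e (φ-neg y) ⟩
      φ y ℤ.+ ℤ.- φ y     ≡⟨ ℤ.+-inverseʳ (φ y) ⟩
      0ℤ ∎

    φ-respects : ∀ {x y} → φ (x ⊖ y) ≡ₚ 0ℤ → φ x ≡ₚ φ y
    φ-respects {x} {y} e = begin
      φ x                   ≈⟨ φ-cong (trans (+-assoc x (- y) y) (trans (+-congˡ (inverseˡ y)) (+-identityʳ x))) ⟨
      φ ((x ⊖ y) + y)       ≈⟨ φ-+ (x ⊖ y) y ⟩
      φ (x ⊖ y) ℤ.+ φ y     ≈⟨ +-congʳₚ (φ y) e ⟩
      0ℤ ℤ.+ φ y            ≡⟨ ℤ.+-identityˡ _ ⟩
      φ y ∎

    kernel-index : HasIndex G kernel p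
    kernel-index = record
      { to        = λ x → residue (φ x)
      ; from      = λ i → toℕ i · β
      ; to-cong   = λ (lift e) → residue-cong (φ-respects e)
      ; from-cong = λ { {i} ≡.refl → lift (φ-⊖ {toℕ i · β} (≡⇒≡ₚ ≡.refl)) }
      ; inverse   = (λ { {i} (lift e) → ≡.trans
                        (residue-cong (≡ₚ-trans (φ-respects e) (φ-·β (toℕ i)))) (residue-toℕ i) })
                  , (λ { {x} ≡.refl → lift (φ-⊖ (≡ₚ-trans (φ-·β _) (toℕ-residue (φ x)))) })
      }

    α : Carrier
    α = - β

    φ-α : φ α ≡ₚ ℤ.- 1ℤ
    φ-α = ≡ₚ-trans (φ-neg β) (neg-congₚ φ-β)

    α∉kernel : ¬ Lift ℓ (φ α ≡ₚ 0ℤ)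
    α∉kernel (lift e) = 1≢ₚ0 (neg-congₚ (≡ₚ-trans (≡ₚ-sym φ-α) e))

    zeros-in-coset : ∀ {x} → to f x ≡ₚ 0ℤ → Coset G α kernel x
    zeros-in-coset {x} e = x ⊖ α ,
      lift (φ-⊖ (≡ₚ-trans (+-congʳₚ (ℤ.- 1ℤ) e) (≡ₚ-sym φ-α))) ,
      sym (trans (sym (+-assoc α x (- α))) (xyx⁻¹≈y α x))

-- Zero-sum free sequences and their products in the group ring.

ℕ-sum≢0 : ∀ {r} (a : Fin r → ℕ) → ℕ-sum a ≢ 0 → ∃[ i ] a i ≢ 0
ℕ-sum≢0 {zero}  a ≢0 = contradiction ≡.refl ≢0
ℕ-sum≢0 {suc r} a ≢0 with a zero ℕ.≟ 0
... | no a₀≢0 = zero , a₀≢0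
... | yes a₀≡0 with ℕ-sum≢0 (a ∘ suc) (λ eq → ≢0 (≡.cong₂ ℕ._+_ a₀≡0 eq))
...   | i , ai≢0 = suc i , ai≢0

module Sequences {c ℓ : Level} (G : AbelianGroup c ℓ) {p : ℕ} (prime : Prime p)
                 {n : ℕ} (order : HasOrder G n) where
  open Additive G
  open Differences G p hiding (resp)
  open Modular p
  open Residues prime
  open Structure G prime order
  open AffineFunctions G prime
  open Func using (to; cong)
  open Sublist setoid using ([]; _∷_; _∷ʳ_; minimum) renaming (_⊆_ to _⊑_)

  powers : ∀ {r} → (Fin r → ℕ) → (Fin r → Carrier) → Sequence G
  powers {zero}  m e = []
  powers {suc r} m e = replicate (m zero) (e zero) ++ powers (m ∘ suc) (e ∘ suc)

  length-powers : ∀ {r} (m : Fin r → ℕ) e → length (powers m e) ≡ ℕ-sum m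
  length-powers {zero}  m e = ≡.refl
  length-powers {suc r} m e = ≡.trans (List.length-++ (replicate (m zero) (e zero)))
    (≡.cong₂ ℕ._+_ (List.length-replicate (m zero)) (length-powers (m ∘ suc) (e ∘ suc)))

  ⊑-replicate-++ : ∀ m x T {S} → S ⊑ replicate m x ++ T →
    ∃[ k ] Σ[ S′ ∈ Sequence G ]
      (k ≤ m × S′ ⊑ T × length S ≡ k ℕ.+ length S′ × sum G S ≈ k · x + sum G S′)
  ⊑-replicate-++ zero    x T {S} S⊑ = 0 , S , z≤n , S⊑ , ≡.refl , sym (+-identityˡ _)
  ⊑-replicate-++ (suc m) x T (_ ∷ʳ S⊑) with ⊑-replicate-++ m x T S⊑
  ... | k , S′ , k≤m , S′⊑ , len , eq = k , S′ , ℕ.m≤n⇒m≤1+n k≤m , S′⊑ , len , eq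
  ⊑-replicate-++ (suc m) x T (y≈x ∷ S⊑) with ⊑-replicate-++ m x T S⊑
  ... | k , S′ , k≤m , S′⊑ , len , eq =
    suc k , S′ , s≤s k≤m , S′⊑ , ≡.cong suc len , trans (+-cong y≈x eq) (sym (+-assoc _ _ _))

  -- Reads off the multiplicities of a subsequence; the length is kept so that a nonempty one yields
  -- a nonzero multiplicity.
  ⊑-powers : ∀ {r} (m : Fin r → ℕ) e {S} → S ⊑ powers m e →
    Σ[ a ∈ (Fin r → ℕ) ] ((∀ i → a i ≤ m i) × length S ≡ ℕ-sum a × sum G S ≈ linear a e)
  ⊑-powers {zero}  m e [] = (λ ()) , (λ ()) , ≡.refl , refl
  ⊑-powers {suc r} m e S⊑ with ⊑-replicate-++ (m zero) (e zero) _ S⊑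
  ... | k , S′ , k≤m , S′⊑ , len , eq with ⊑-powers (m ∘ suc) (e ∘ suc) S′⊑
  ...   | a , a≤m , len′ , eq′ = k Vector.∷ a , (λ { zero → k≤m ; (suc i) → a≤m i }) ,
          ≡.trans len (≡.cong (k ℕ.+_) len′) , trans eq (+-congˡ eq′)

  exponents : ∀ {r} → Generators r → Fin r → ℕ
  exponents E i = ℕ.pred (p ℕ.^ Generators.t E i)

  -- The multiplicities in a nonempty zero-sum subsequence are at most qᵢ - 1 and not all zero: a
  -- relation excluded by independence.
  independent⇒zero-sum-free : ∀ {r} (E : Generators r) → Independent E →
    ZeroSumFree G (powers (exponents E) (Generators.e E))
  independent⇒zero-sum-free E ind (S , S⊑ , S≢[] , 0≈) with ⊑-powers (exponents E) (Generators.e E) S⊑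
  ... | a , a≤ , len , eq = ind (a ,
        (λ i → ℕ.≤-<-trans (a≤ i) (ℕ.≤-reflexive
          (ℕ.suc-pred _ {{ℕ.m^n≢0 p (Generators.t E i) {{prime⇒nonZero prime}}}}))) ,
        trans (sym eq) (sym 0≈) ,
        ℕ-sum≢0 a λ sum≡0 → S≢[] (empty S (≡.trans len sum≡0)))
    where
    empty : ∀ (S : Sequence G) → length S ≡ 0 → S ≡ []
    empty [] _ = ≡.refl

  ZeroSumFree-tail : ∀ {g T} → ZeroSumFree G (g ∷ T) → ZeroSumFree G T
  ZeroSumFree-tail zsf (S , S⊑ , S≢[] , eq) = zsf (S , _ ∷ʳ S⊑ , S≢[] , eq)

  Missing : Sequence G → Carrier → Set (c ⊔ ℓ)
  Missing T = Nonzero G ∖ SubsequenceSums G T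

  -- Σ(T) ∪ {0}: the empty subsequence counts, as it does in the expansion of ∏ (1 - X^g).
  SubsequenceSums₀ : Sequence G → Carrier → Set (c ⊔ ℓ)
  SubsequenceSums₀ T x = ∃[ S ] (S ⊑ T × x ≈ sum G S)

  missing⇒∉ : ∀ {T x} → Missing T x → x ∉ SubsequenceSums₀ T
  missing⇒∉ (x≉0 , x∉) ([] , S⊑ , eq)         = x≉0 eq
  missing⇒∉ (x≉0 , x∉) (S@(_ ∷ _) , S⊑ , eq)  = x∉ (S , S⊑ , (λ ()) , eq)

  -- A subsequence of `T` with sum -g, even an empty one, becomes a nonempty zero-sum sequence once
  -- g is prepended.
  head-complement : ∀ {g T x} → ZeroSumFree G (g ∷ T) → g + x ≈ 0# → x ∉ SubsequenceSums₀ T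
  head-complement {g} zsf g+x≈0 (S , S⊑ , eq) =
    zsf (g ∷ S , refl ∷ S⊑ , (λ ()) , sym (trans (+-congˡ (sym eq)) g+x≈0))

  δ : Fun
  δ = record { to = indicator ; cong = indicator-cong }
    where
    indicator : Carrier → ℤ
    indicator x with x ≟ 0#
    ... | yes _ = 1ℤ
    ... | no _  = 0ℤ
    indicator-cong : ∀ {x y} → x ≈ y → indicator x ≡ indicator y
    indicator-cong {x} {y} x≈y with x ≟ 0# | y ≟ 0#
    ... | yes _ | yes _ = ≡.refl
    ... | no _  | no _  = ≡.refl
    ... | yes x≈0 | no y≉0 = contradiction (trans (sym x≈y) x≈0) y≉0
    ... | no x≉0 | yes y≈0 = contradiction (trans x≈y y≈0) x≉0

  -- The coefficient function of ∏ (1 - X^g) in the group ring: N T x counts the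
  -- subsequences of T with sum x, weighted by (-1)^length.
  N : Sequence G → Fun
  N []      = δ
  N (g ∷ T) = Δ g (N T)

  δ-zero : ∀ {x} → x ≈ 0# → to δ x ≡ 1ℤ
  δ-zero {x} x≈0 with x ≟ 0#
  ... | yes _  = ≡.refl
  ... | no x≉0 = contradiction x≈0 x≉0

  -- The two terms of the difference belong to the subsequences omitting g, with sum x in `T`, and
  -- those using g, with sum x - g in `T`.
  N-∉ : ∀ T {x} → x ∉ SubsequenceSums₀ T → to (N T) x ≡ 0ℤ
  N-∉ [] {x} x∉ with x ≟ 0#
  ... | yes x≈0 = contradiction ([] , [] , x≈0) x∉
  ... | no _    = ≡.refl
  N-∉ (g ∷ T) {x} x∉ = ≡.cong₂ (λ a b → a ℤ.+ ℤ.- b)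
    (N-∉ T λ (S , S⊑ , eq) → x∉ (S , g ∷ʳ S⊑ , eq))
    (N-∉ T λ (S , S⊑ , eq) → x∉ (g ∷ S , refl ∷ S⊑ , trans (sym (add-back x)) (+-congˡ eq)))
    where
    add-back : ∀ x → g + (x ⊖ g) ≈ x
    add-back x = trans (sym (+-assoc g x (- g))) (xyx⁻¹≈y g x)

  -- Passing from `T` to `g ∷ T` subtracts the value at -g, which is 0 because -g is not a
  -- subsequence sum of `T`.
  N-0 : ∀ T → ZeroSumFree G T → to (N T) 0# ≡ 1ℤ
  N-0 []      zsf = δ-zero refl
  N-0 (g ∷ T) zsf = ≡.cong₂ (λ a b → a ℤ.+ ℤ.- b) (N-0 T (ZeroSumFree-tail zsf))
    (N-∉ T (head-complement zsf (trans (+-congˡ (+-identityˡ (- g))) (inverseʳ g))))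

  -- Each factor 1 - X^g of `N T` is itself a difference and uses up one order of vanishing of `δ`.
  Deg-N : ∀ k T → Deg id (k ℕ.+ length T) δ → Deg id k (N T)
  Deg-N k []      d = ≡.subst (λ m → Deg id m δ) (ℕ.+-identityʳ k) d
  Deg-N k (g ∷ T) d with Deg-N (suc k) T (≡.subst (λ m → Deg id m δ) (ℕ.+-suc k (length T)) d)
  ... | differ d′ = d′ g

  -- Write the missing elements -g, -h, -(g + h) as α + a, α + b, α + d with a, b, d in H. Adding
  -- the first two gives d = α + a + b, so α lies in H.
  missing-not-in-coset : ∀ {g h S} → ZeroSumFree G (g ∷ h ∷ S) → ∀ (H : Subgroup G) {α} →
    ¬ Subgroup.⟦ H ⟧ α → ¬ (Missing S ⊆ Coset G α H)
  missing-not-in-coset {g} {h} {S} zsf H {α} α∉H cover =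
    α∉H (resp combine (+-closed d∈H (neg-mem (+-closed a∈H b∈H))))
    where
    open Subgroup H using (resp; +-closed; neg-mem)
    zsf-g : ZeroSumFree G (g ∷ S)
    zsf-g (S′ , (_ ∷ʳ S′⊑) , rest)  = zsf (S′ , (g ∷ʳ (h ∷ʳ S′⊑)) , rest)
    zsf-g (_ , (eq ∷ S′⊑) , rest)   = zsf (_ , (eq ∷ (h ∷ʳ S′⊑)) , rest)
    zsf-g+h : ZeroSumFree G ((g + h) ∷ S)
    zsf-g+h (S′ , (_ ∷ʳ S′⊑) , rest) = zsf (S′ , (g ∷ʳ (h ∷ʳ S′⊑)) , rest)
    zsf-g+h (x ∷ S′ , (x≈g+h ∷ S′⊑) , _ , eq) = zsf (g ∷ h ∷ S′ , (refl ∷ (refl ∷ S′⊑)) , (λ ()) ,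
      trans eq (trans (+-congʳ x≈g+h) (+-assoc g h _)))
    missing-neg : ∀ {x} → ZeroSumFree G (x ∷ S) → Missing S (- x)
    missing-neg {x} z =
      (λ -x≈0 → z (x ∷ [] , refl ∷ minimum S , (λ ()) ,
        trans (sym (inverseʳ x)) (+-congˡ -x≈0))) ,
      (λ (S′ , S′⊑ , _ , eq) → head-complement z (inverseʳ x) (S′ , S′⊑ , eq))
    cosetʰ  = cover (missing-neg (ZeroSumFree-tail zsf))
    cosetᵍ  = cover (missing-neg zsf-g)
    cosetᵍʰ = cover (missing-neg zsf-g+h)
    a = proj₁ cosetᵍ
    b = proj₁ cosetʰ
    d = proj₁ cosetᵍʰ
    a∈H = proj₁ (proj₂ cosetᵍ)
    b∈H = proj₁ (proj₂ cosetʰ)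
    d∈H = proj₁ (proj₂ cosetᵍʰ)
    open import Relation.Binary.Reasoning.Setoid setoid
    d≈ : d ≈ α + (a + b)
    d≈ = ∙-cancelˡ α d (α + (a + b)) (begin
      α + d               ≈⟨ proj₂ (proj₂ cosetᵍʰ) ⟨
      - (g + h)           ≈⟨ ⁻¹-∙-comm g h ⟨
      - g + - h           ≈⟨ +-cong (proj₂ (proj₂ cosetᵍ)) (proj₂ (proj₂ cosetʰ)) ⟩
      (α + a) + (α + b)   ≈⟨ +-assoc α a (α + b) ⟩
      α + (a + (α + b))   ≈⟨ +-congˡ (+-assoc a α b) ⟨
      α + ((a + α) + b)   ≈⟨ +-congˡ (+-congʳ (+-comm a α)) ⟩
      α + ((α + a) + b)   ≈⟨ +-congˡ (+-assoc α a b) ⟩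
      α + (α + (a + b))   ∎)
    combine : d ⊖ (a + b) ≈ α
    combine = begin
      d ⊖ (a + b)                  ≈⟨ +-congʳ d≈ ⟩
      (α + (a + b)) ⊖ (a + b)      ≈⟨ +-assoc α _ _ ⟩
      α + ((a + b) ⊖ (a + b))      ≈⟨ +-congˡ (inverseʳ _) ⟩
      α + 0#                       ≈⟨ +-identityʳ α ⟩
      α ∎

  -- The values of d(G), ν(G) and ν_p(G).

  module Extremal {r} (E : Generators r) (ind : Independent E) {x : Carrier} (x≉0 : ¬ x ≈ 0#) where
    open Generators E

    d : ℕ
    d = ℕ-sum (exponents E)

    T₀ : Sequence G
    T₀ = powers (exponents E) e

    T₀-zsf : ZeroSumFree G T₀
    T₀-zsf = independent⇒zero-sum-free E ind

    T₀-length : length T₀ ≡ d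
    T₀-length = length-powers (exponents E) e

    Deg-≥ : ∀ j f → Deg id (j ℕ.+ suc d) f
    Deg-≥ zero    f = Deg-all prime e t span torsion f
    Deg-≥ (suc j) f = differ λ g → Deg-≥ j (Δ g f)

    Deg-> : ∀ {m} → d < m → ∀ f → Deg id m f
    Deg-> {m} d<m f = ≡.subst (λ k → Deg id k f) (ℕ.m∸n+n≡m d<m) (Deg-≥ (m ℕ.∸ suc d) f)

    -- For longer `T` the function `N T` vanishes modulo p, against its value 1 at 0.
    zsf⇒length≤d : ∀ T → ZeroSumFree G T → length T ≤ d
    zsf⇒length≤d T zsf = ℕ.≮⇒≥ λ d<len → vanishing (Deg-N 0 T (Deg-> d<len δ))
      where
      vanishing : ¬ Deg id 0 (N T)
      vanishing (vanish v) = 1≢ₚ0 (≡.subst (_≡ₚ 0ℤ) (N-0 T zsf) (v 0#))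

    -- The one-term sequence of the nonzero `x` is zero-sum free. This makes `ℕ.pred d` the true d -
    -- 1.
    d≥1 : 1 ≤ d
    d≥1 = zsf⇒length≤d (x ∷ []) λ
      { (_ , (_ ∷ʳ []) , S≢[] , _) → S≢[] ≡.refl
      ; (_ , (y≈x ∷ []) , _ , eq) → x≉0 (trans (sym y≈x) (trans (sym (+-identityʳ _)) (sym eq))) }

    -- The terms of `T` and two further steps make more than d differences of `δ`, so the second
    -- differences of `N T` vanish.
    N-affine : ∀ T → ZeroSumFree G T → ℕ.pred d ≤ length T → Affine (N T)
    N-affine T zsf len = Deg-2⇒affine (Deg-N 2 T (Deg-> (s≤s d≤1+len) δ)) (≡⇒≡ₚ (N-0 T zsf))
      where
      d≤1+len : d ≤ suc (length T)
      d≤1+len = ℕ.≤-trans (ℕ.≤-reflexive (≡.sym (ℕ.suc-pred d {{ℕ.>-nonZero d≥1}}))) (s≤s len)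

    Covered : Sequence G → Set _
    Covered T = Σ[ H ∈ Subgroup G ] (HasIndex G H p ×
      ∃[ α ] (α ∉ Subgroup.⟦ H ⟧ × Missing T ⊆ Coset G α H))

    -- Drop the first term g of an extremal sequence: the rest has length d - 1, so its `N` is
    -- affine, and it vanishes at -g.
    nonconstant-exists : ∃[ f ] (Affine f × ∃[ x₀ ] ¬ to f x₀ ≡ₚ 1ℤ)
    nonconstant-exists = go T₀ T₀-zsf T₀-length
      where
      go : ∀ T → ZeroSumFree G T → length T ≡ d → ∃[ f ] (Affine f × ∃[ x₀ ] ¬ to f x₀ ≡ₚ 1ℤ)
      go []      zsf eq = contradiction d≥1 (≡.subst (λ m → ¬ 1 ≤ m) eq λ ())
      go (g ∷ T) zsf eq = N T ,
        N-affine T (ZeroSumFree-tail zsf) (ℕ.≤-reflexive (≡.cong ℕ.pred (≡.sym eq))) ,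
        - g , λ e → 1≢ₚ0 (≡ₚ-trans (≡ₚ-sym e) (≡⇒≡ₚ (N-∉ T (head-complement zsf (inverseʳ g)))))

    covered : ∀ T → ZeroSumFree G T → ℕ.pred d ≤ length T → Covered T
    -- Finiteness of G decides whether `N T` is constant modulo p.
    covered T zsf len with Fin.any? (λ i → ¬? (to (N T) (Inverse.from order i) ≟ₚ 1ℤ))
    ... | yes (i , ≢1) = kernel , kernel-index , α , α∉kernel ,
          λ m → zeros-in-coset (≡⇒≡ₚ (N-∉ T (missing⇒∉ m)))
      where open Kernel (N-affine T zsf len) ≢1
    -- Now `N T` is 1 everywhere and nothing is missing. A subgroup of index p must still be
    -- exhibited; the kernel of any nonconstant affine function provides one.
    ... | no constant with nonconstant-exists
    ...   | f , affine , x₀ , ≢1 = kernel , kernel-index , α , α∉kernel , λ {x} m →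
            contradiction (≡ₚ-trans (≡ₚ-sym (N≡1 x)) (≡⇒≡ₚ (N-∉ T (missing⇒∉ m)))) 1≢ₚ0
      where
      open Kernel affine ≢1
      N≡1 : ∀ x → to (N T) x ≡ₚ 1ℤ
      N≡1 x = ≡ₚ-trans (≡⇒≡ₚ (cong (N T) (sym (Inverse.strictlyInverseʳ order x))))
        (decidable-stable (_ ≟ₚ _) λ ≢1 → constant (Inverse.to order x , ≢1))

    -- If l < d - 1, an extremal sequence without two of its terms has length d - 2 ≥ l, against
    -- `missing-not-in-coset`. The covering assumed is the common part of both definitions, so the
    -- bound serves ν and ν_p alike.
    pred-d≤ : ∀ l → (∀ T → ZeroSumFree G T → length T ≥ l →
      Σ[ H ∈ Subgroup G ] ∃[ α ] (α ∉ Subgroup.⟦ H ⟧ × Missing T ⊆ Coset G α H)) → ℕ.pred d ≤ l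
    pred-d≤ l cover = ℕ.≮⇒≥ (go T₀ T₀-zsf T₀-length)
      where
      go : ∀ T → ZeroSumFree G T → length T ≡ d → ¬ l < ℕ.pred d
      -- Below length two `ℕ.pred d` is 0, and no l is smaller.
      go []          zsf eq l< = contradiction (≡.subst (λ m → l < ℕ.pred m) (≡.sym eq) l<) λ ()
      go (g ∷ [])    zsf eq l< = contradiction (≡.subst (λ m → l < ℕ.pred m) (≡.sym eq) l<) λ ()
      go (g ∷ h ∷ S) zsf eq l< with cover S (ZeroSumFree-tail (ZeroSumFree-tail zsf))
        (ℕ.s≤s⁻¹ (≡.subst (λ m → l < ℕ.pred m) (≡.sym eq) l<))
      ... | H , α , α∉H , covers = missing-not-in-coset zsf H α∉H covers

    is-d : Is-d G d
    is-d = (T₀ , T₀-zsf , T₀-length) , λ { m (T , zsf , ≡.refl) → zsf⇒length≤d T zsf }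

    is-νₚ : Is-ν[_] G p (ℕ.pred d)
    is-νₚ = covered , λ l cover → pred-d≤ l λ T zsf len →
      let H , _ , rest = cover T zsf len in H , rest

    is-ν : Is-ν G (ℕ.pred d)
    is-ν = (λ T zsf len → let H , _ , α , α∉H , covers = covered T zsf len in
              H , (_ , λ U⊆H → α∉H (U⊆H _)) , α , α∉H , covers) ,
           λ l cover → pred-d≤ l λ T zsf len → let H , _ , rest = cover T zsf len in H , rest

  nonzero-element : 1 < n → ∃[ x ] ¬ x ≈ 0#
  nonzero-element 1<n = distinguish (from i₀ ≟ 0#) (from i₁ ≟ 0#)
    where
    open Inverse order using (from; to-cong; strictlyInverseˡ)
    i₀ i₁ : Fin n
    i₀ = fromℕ< (ℕ.<-trans ℕ.z<s 1<n)
    i₁ = fromℕ< 1<n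
    from-injective : ∀ {i j} → from i ≈ from j → i ≡ j
    from-injective e = ≡.trans (≡.sym (strictlyInverseˡ _)) (≡.trans (to-cong e) (strictlyInverseˡ _))
    distinguish : Dec (from i₀ ≈ 0#) → Dec (from i₁ ≈ 0#) → ∃[ x ] ¬ x ≈ 0#
    distinguish (no ≉0) _        = _ , ≉0
    distinguish (yes _) (no ≉0)  = _ , ≉0
    distinguish (yes e) (yes e′) =
      contradiction (Fin.fromℕ<-injective _ _ _ _ (from-injective (trans e (sym e′)))) λ ()

theorem3p5 : ∀ {c ℓ} (p : ℕ) → Prime p →
    (G : AbelianGroup c ℓ) (n : ℕ) → HasOrder G n → (∃[ k ] n ≡ p ^ k) → n ≥ p →
    ∃[ ν ] ∃[ νₚ ] ∃[ d ]
    (Is-ν G ν × Is-ν[_] G p νₚ × Is-d G d × ν ≡ νₚ × + νₚ ≡ + d - 1ℤ)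
theorem3p5 p p-prime G n order (k , n≡p^k) n≥p =
  ℕ.pred d , ℕ.pred d , d , is-ν , is-νₚ , is-d , ≡.refl , pred-minus-one d≥1
  where
  open Structure G p-prime order using (independent-generators; all-elements)
  open Sequences G p-prime order
  E = independent-generators (all-elements {k} n≡p^k)
  x≉0 = nonzero-element (ℕ.<-≤-trans (ℕ.nonTrivial⇒n>1 p {{prime⇒nonTrivial p-prime}}) n≥p)
  open Extremal (proj₁ E) (proj₂ E) (proj₂ x≉0)
  pred-minus-one : ∀ {m} → 1 ≤ m → + ℕ.pred m ≡ + m ℤ.- 1ℤ
  pred-minus-one (s≤s _) = ≡.refl
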